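{- Let $\mathcal{H}$ be a fixed finite set of connected graphs, let $D$ be the maximum diameter of the graphs in $\mathcal{H}$, suppose $\mathcal{H}$ contains $K_{1,s}$ for some $s>1$, and let $s>1$ be the least such integer. Fix an integer $t>2$, let $d=R(s,t-1)-1$ and $p=\log_{\frac{2d}{2d-1}}d$. Consider the following procedure, applied to an instance $(G,k)$ of $\mathcal{H}$-free Edge Deletion in which $G$ is $K_t$-free: (1) Let $V_R(G)$ be the set of vertices of $G$ of degree at least $d+1$. Delete from $G$ all vertices whose distance from $V_{\mathcal{H}}(G)\cup V_R(G)$ is more than $(2+\log_{\frac{2d}{2d-1}}k)D$; call the resulting graph $G'$. (2) If $|V(G')|>8d^{3D+1}\cdot k^{pD+1}$, output the instance $(K_{1,s},0)$; otherwise output $(G',k)$. Then the output instance has at most $8d^{1+3D}\cdot k^{1+pD}$ vertices, and it is a yes-instance of $\mathcal{H}$-free Edge Deletion if and only if $(G,k)$ is a yes-instance.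
   Context: All graphs are finite and simple. $R(s,t)$ is the Ramsey number: the least integer such that every graph on $R(s,t)$ vertices has an independent set of order $s$ or a complete subgraph of order $t$. For a set of graphs $\mathcal{H}$, a graph is $\mathcal{H}$-free if it has no induced subgraph isomorphic to a member of $\mathcal{H}$. The problem $\mathcal{H}$-free Edge Deletion: given a graph $G$ and a positive integer $k$ (the parameter), decide whether there exists $E'\subseteq E(G)$ with $|E'|\le k$ such that $G\setminus E'=(V(G),E(G)\setminus E')$ is $\mathcal{H}$-free. $V_{\mathcal{H}}(G)$ denotes the set of all vertices of $G$ that belong to some induced subgraph of $G$ isomorphic to a member of $\mathcal{H}$. The distance from a vertex $v$ to a set of vertices $V'$ is the minimum of the distances from $v$ to the vertices of $V'$. -}

module Defs where

open import Data.Nat using (ℕ; zero; suc; _+_; _*_; _∸_; _^_; _≤_; _<_; _<ᵇ_)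
open import Data.Bool using (Bool; true; false; if_then_else_; _∧_; not)
open import Data.Fin using (Fin; toℕ)
open import Data.List using (List; map; allFin)
open import Data.Nat.ListAction using (sum)
open import Data.List.Membership.Propositional using (_∈_)
open import Data.Product using (Σ; ∃; ∃-syntax; _×_; _,_)
open import Data.Sum using (_⊎_)
open import Relation.Nullary using (¬_)
open import Relation.Binary.PropositionalEquality using (_≡_; _≢_)
open import Function.Bundles using (_⇔_)

record Graph : Set where
  field
    size   : ℕ
    adj    : Fin size → Fin size → Bool
    sym    : ∀ i j → adj i j ≡ adj j i
    irrefl : ∀ i → adj i i ≡ false
open Graph public

Injective : ∀ {m n} → (Fin m → Fin n) → Set
Injective f = ∀ i j → f i ≡ f j → i ≡ j

record InducedEmb (F G : Graph) : Set where
  field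
    emb      : Fin (size F) → Fin (size G)
    emb-inj  : Injective emb
    emb-adj  : ∀ i j → adj G (emb i) (emb j) ≡ adj F i j
open InducedEmb public

InducedIn : Graph → Graph → Set
InducedIn F G = InducedEmb F G

Iso : Graph → Graph → Set
Iso F G = Σ (InducedEmb F G) λ e → ∀ v → ∃[ i ] emb e i ≡ v

Free : List Graph → Graph → Set
Free ℋ G = ∀ F → F ∈ ℋ → ¬ InducedIn F G

InVH : (ℋ : List Graph) (G : Graph) → Fin (size G) → Set
InVH ℋ G v = ∃[ F ] (F ∈ ℋ × Σ (InducedEmb F G) λ e → ∃[ i ] emb e i ≡ v)

degree : (G : Graph) → Fin (size G) → ℕ
degree G v = sum (map (λ u → if adj G v u then 1 else 0) (allFin (size G)))

HasClique : Graph → ℕ → Set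
HasClique G t = Σ (Fin t → Fin (size G)) λ f →
  Injective f × (∀ i j → i ≢ j → adj G (f i) (f j) ≡ true)

HasIndep : Graph → ℕ → Set
HasIndep G s = Σ (Fin s → Fin (size G)) λ f →
  Injective f × (∀ i j → i ≢ j → adj G (f i) (f j) ≡ false)

RamseyProp : ℕ → ℕ → ℕ → Set
RamseyProp s t N = ∀ G → size G ≡ N → HasIndep G s ⊎ HasClique G t

IsRamsey : ℕ → ℕ → ℕ → Set
IsRamsey s t R = RamseyProp s t R × (∀ N → N < R → ¬ RamseyProp s t N)

starAdj : (s : ℕ) → Fin (suc s) → Fin (suc s) → Bool
starAdj s Fin.zero Fin.zero = false
starAdj s Fin.zero (Fin.suc _) = true
starAdj s (Fin.suc _) Fin.zero = true
starAdj s (Fin.suc _) (Fin.suc _) = false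

starSym : (s : ℕ) → ∀ i j → starAdj s i j ≡ starAdj s j i
starSym s Fin.zero Fin.zero = Relation.Binary.PropositionalEquality.refl
starSym s Fin.zero (Fin.suc _) = Relation.Binary.PropositionalEquality.refl
starSym s (Fin.suc _) Fin.zero = Relation.Binary.PropositionalEquality.refl
starSym s (Fin.suc _) (Fin.suc _) = Relation.Binary.PropositionalEquality.refl

starIrr : (s : ℕ) → ∀ i → starAdj s i i ≡ false
starIrr s Fin.zero = Relation.Binary.PropositionalEquality.refl
starIrr s (Fin.suc _) = Relation.Binary.PropositionalEquality.refl

star : ℕ → Graph
star s = record { size = suc s ; adj = starAdj s ; sym = starSym s ; irrefl = starIrr s }

ContainsStar : List Graph → ℕ → Set
ContainsStar ℋ s = ∃[ F ] (F ∈ ℋ × Iso F (star s))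

data Walk (G : Graph) : Fin (size G) → Fin (size G) → ℕ → Set where
  here : ∀ {u} → Walk G u u 0
  step : ∀ {u w v m} → adj G u w ≡ true → Walk G w v m → Walk G u v (suc m)

Connected : Graph → Set
Connected G = ∀ u v → ∃[ ℓ ] Walk G u v ℓ

IsMaxDiameter : List Graph → ℕ → Set
IsMaxDiameter ℋ D =
  (∀ F → F ∈ ℋ → ∀ u v → ∃[ ℓ ] (ℓ ≤ D × Walk F u v ℓ)) ×
  (∃[ F ] (F ∈ ℋ × ∃[ u ] ∃[ v ] (∀ ℓ → Walk F u v ℓ → D ≤ ℓ)))

record SpanningSub (G : Graph) : Set where
  field
    sadj    : Fin (size G) → Fin (size G) → Bool
    ssym    : ∀ i j → sadj i j ≡ sadj j i
    sirrefl : ∀ i → sadj i i ≡ false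
    ssub    : ∀ i j → sadj i j ≡ true → adj G i j ≡ true
open SpanningSub public

subGraph : (G : Graph) → SpanningSub G → Graph
subGraph G S = record { size = size G ; adj = sadj S ; sym = ssym S ; irrefl = sirrefl S }

deleted : (G : Graph) → SpanningSub G → ℕ
deleted G S = sum (map (λ i → sum (map (λ j →
    if (toℕ i <ᵇ toℕ j) ∧ adj G i j ∧ not (sadj S i j) then 1 else 0)
    (allFin (size G)))) (allFin (size G)))

YesInstance : List Graph → Graph → ℕ → Set
YesInstance ℋ G k = Σ (SpanningSub G) λ S → deleted G S ≤ k × Free ℋ (subGraph G S)

-- Real-valued thresholds, encoded exactly in ℕ.  b = 2d/(2d-1).

-- ℓ ≤ (2 + log_b k)·D   ⇔   b^(ℓ - 2D) ≤ k^D   (k ≥ 1)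
--                       ⇔   (2d)^(ℓ∸2D) ≤ k^D · (2d-1)^(ℓ∸2D)
WithinRadius : (d D k ℓ : ℕ) → Set
WithinRadius d D k ℓ =
  (2 * d) ^ (ℓ ∸ 2 * D) ≤ k ^ D * (2 * d ∸ 1) ^ (ℓ ∸ 2 * D)

Kept : (ℋ : List Graph) (d D k : ℕ) (G : Graph) → Fin (size G) → Set
Kept ℋ d D k G v = ∃[ u ] ((InVH ℋ G u ⊎ suc d ≤ degree G u) ×
                           ∃[ ℓ ] (Walk G v u ℓ × WithinRadius d D k ℓ))

-- N > 8·d^(3D+1)·k^(pD+1), p = log_b d.  With C = 8·d^(3D+1)·k this is
-- N/C > k^(pD), which holds iff there is a rational a/c > pD with
-- k^(a/c) < N/C;  a/c > pD ⇔ b^a > d^(Dc) ⇔ (2d)^a > d^(Dc)·(2d-1)^a.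
Exceeds : (d D k N : ℕ) → Set
Exceeds d D k N = ∃[ a ] ∃[ c ] (1 ≤ c ×
  d ^ (D * c) * (2 * d ∸ 1) ^ a < (2 * d) ^ a ×
  k ^ a * (8 * d ^ (3 * D + 1) * k) ^ c < N ^ c)

{-# OPTIONS --safe #-}

-- Take a solution S of the kernel G′ that cannot be improved by the following exchange.
-- Grow a set C of deleted edges in layers, starting with those that meet V_H: the next
-- layer consists of the remaining deleted edges lying in a copy inside G′ ∖ C.  Isolating
-- the endpoints of the next layer (all outside V_H, hence of degree ≤ d) also destroys all
-- copies, so by the exchange the next layer has at least 1/(2d) of the remaining edges.
-- Hence there are at most 1 + log_b k layers with b = 2d/(2d-1), each D further away from V_H.
-- A copy in G that appears after deleting S is within D of such an edge, so it lies in G′,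
-- where S has destroyed it.  By Ramsey, vertices of degree > d are already in V_H.
--
-- For the size, the solved graph G ∖ S contains neither K_t nor K_{1,s}, so its degrees are
-- at most d, and every kept vertex is within (3 + log_b k) D of the at most 2k endpoints of
-- deleted edges.
module Submission where

open import Defs
open import Data.Bool using (Bool; true; false; if_then_else_; _∧_; _∨_; not)
open import Data.Bool.Properties using (T-≡; ∧-conicalˡ; ∧-conicalʳ; ∨-comm) renaming (_≟_ to _≟ᵇ_)
open import Data.Empty using (⊥; ⊥-elim)
open import Data.Fin using (Fin; zero; suc; toℕ; finToFun; funToFin)
open import Data.Fin.Properties
  using (_≟_; suc-injective; toℕ-injective; any?; all?; finToFun-funToFin; injective⇒≤)
open import Data.List using (List; map; allFin)
open import Data.List.Membership.Propositional using (_∈_; find; lose)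
open import Data.List.Properties using (map-tabulate)
open import Data.List.Relation.Unary.All using (All)
import Data.List.Relation.Unary.Any as Any
import Data.Nat as ℕ
open import Data.Nat hiding (_≟_)
open import Data.Nat.ListAction using (sum)
open import Data.Nat.Properties hiding (_≟_; suc-injective)
open import Data.Nat.Tactic.RingSolver using (solve-∀)
open import Data.Product using (Σ; ∃; ∃-syntax; _×_; _,_; proj₁; proj₂)
open import Data.Sum using (_⊎_; inj₁; inj₂; [_,_]′)
open import Data.Vec.Functional using (_∷_)
open import Function using (_∘_; id)
open import Function.Bundles using (_⇔_; mk⇔; Equivalence)
open import Relation.Binary.PropositionalEquality
  using (_≡_; _≢_; refl; cong; cong₂; subst; trans; module ≡-Reasoning) renaming (sym to ≡-sym)
open import Relation.Nullary using (¬_; Dec; yes; no; does; _×-dec_; _→-dec_; map′)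
open import Relation.Nullary.Decidable using (dec-true)

private
  variable
    m n N : ℕ
    F G H : Graph

-- Finite sums over `Fin n`.

ι : Bool → ℕ
ι b = if b then 1 else 0

ι-≤ : ∀ b {c} → (b ≡ true → 1 ≤ c) → ι b ≤ c
ι-≤ true  h = h refl
ι-≤ false h = z≤n

ι-mono : ∀ b c → (b ≡ true → c ≡ true) → ι b ≤ ι c
ι-mono b c h = ι-≤ b (λ p → ≤-reflexive (cong ι (≡-sym (h p))))

-- Definitionally the sum in which degree and deleted are expressed.
∑ : (Fin n → ℕ) → ℕ
∑ {n} f = sum (map f (allFin n))

∑-suc : (f : Fin (suc n) → ℕ) → ∑ f ≡ f zero + ∑ (f ∘ suc)
∑-suc f = cong (λ xs → f zero + sum xs)
  (trans (map-tabulate suc f) (≡-sym (map-tabulate id (f ∘ suc))))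

∑-mono : {f g : Fin n → ℕ} → (∀ i → f i ≤ g i) → ∑ f ≤ ∑ g
∑-mono {zero}  h = z≤n
∑-mono {suc n} {f} {g} h rewrite ∑-suc f | ∑-suc g = +-mono-≤ (h zero) (∑-mono (h ∘ suc))

∑-cong : {f g : Fin n → ℕ} → (∀ i → f i ≡ g i) → ∑ f ≡ ∑ g
∑-cong h = ≤-antisym (∑-mono (≤-reflexive ∘ h)) (∑-mono (≤-reflexive ∘ ≡-sym ∘ h))

∑-0 : ∀ n → ∑ {n} (λ _ → 0) ≡ 0
∑-0 zero    = refl
∑-0 (suc n) = trans (∑-suc {n} (λ _ → 0)) (∑-0 n)

∑-1 : ∀ n → ∑ {n} (λ _ → 1) ≡ n
∑-1 zero    = refl
∑-1 (suc n) = trans (∑-suc {n} (λ _ → 1)) (cong suc (∑-1 n))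

∑-+ : (f g : Fin n → ℕ) → ∑ (λ i → f i + g i) ≡ ∑ f + ∑ g
∑-+ {zero}  f g = refl
∑-+ {suc n} f g rewrite ∑-suc (λ i → f i + g i) | ∑-suc f | ∑-suc g | ∑-+ (f ∘ suc) (g ∘ suc) =
  interchange (f zero) (g zero) (∑ (f ∘ suc)) (∑ (g ∘ suc))
  where
  interchange : ∀ a b c d → a + b + (c + d) ≡ a + c + (b + d)
  interchange = solve-∀

∑-* : ∀ a (f : Fin n → ℕ) → ∑ (λ i → a * f i) ≡ a * ∑ f
∑-* {zero}  a f = ≡-sym (*-zeroʳ a)
∑-* {suc n} a f rewrite ∑-suc (λ i → a * f i) | ∑-suc f | ∑-* a (f ∘ suc) =
  ≡-sym (*-distribˡ-+ a (f zero) _)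

∑-swap : (f : Fin m → Fin n → ℕ) → ∑ (λ i → ∑ (λ j → f i j)) ≡ ∑ (λ j → ∑ (λ i → f i j))
∑-swap {zero}  {n} f = ≡-sym (∑-0 n)
∑-swap {suc m} {n} f = begin
  ∑ (λ i → ∑ (f i))                           ≡⟨ ∑-suc (λ i → ∑ (f i)) ⟩
  ∑ (f zero) + ∑ (λ i → ∑ (f (suc i)))         ≡⟨ cong (∑ (f zero) +_) (∑-swap (f ∘ suc)) ⟩
  ∑ (f zero) + ∑ (λ j → ∑ (λ i → f (suc i) j)) ≡⟨ ≡-sym (∑-+ (f zero) _) ⟩
  ∑ (λ j → f zero j + ∑ (λ i → f (suc i) j))   ≡⟨ ∑-cong (λ j → ≡-sym (∑-suc (λ i → f i j))) ⟩
  ∑ (λ j → ∑ (λ i → f i j))                    ∎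
  where open ≡-Reasoning

term≤∑ : (f : Fin n → ℕ) → ∀ i → f i ≤ ∑ f
term≤∑ f zero    rewrite ∑-suc f = m≤m+n _ _
term≤∑ f (suc i) rewrite ∑-suc f = ≤-trans (term≤∑ (f ∘ suc) i) (m≤n+m _ _)

δ : Fin n → Fin n → ℕ
δ i j = ι (does (i ≟ j))

δ-refl : (i : Fin n) → δ i i ≡ 1
δ-refl zero    = refl
δ-refl (suc i) = δ-refl i

∑-δ : (i : Fin n) (f : Fin n → ℕ) → ∑ (λ j → δ i j * f j) ≡ f i
∑-δ {suc n} zero f
  rewrite ∑-suc (λ j → δ zero j * f j) | ∑-0 n = trans (+-identityʳ _) (+-identityʳ _)
∑-δ {suc n} (suc i) f
  rewrite ∑-suc (λ j → δ (suc i) j * f j) = ∑-δ i (f ∘ suc)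

∑-δ-injective : (e : Fin N → Fin n) → Injective e → ∀ v → ∑ (λ i → δ (e i) v) ≤ 1
∑-δ-injective {zero}  e inj v = z≤n
∑-δ-injective {suc N} e inj v rewrite ∑-suc (λ i → δ (e i) v) with e zero ≟ v
... | no _     = ∑-δ-injective (e ∘ suc) (λ i j p → suc-injective (inj (suc i) (suc j) p)) v
... | yes refl = s≤s (≤-trans (∑-mono (λ i → ≤-reflexive (others i))) (≤-reflexive (∑-0 N)))
  where
  others : ∀ i → δ (e (suc i)) (e zero) ≡ 0
  others i with e (suc i) ≟ e zero
  ... | yes p with () ← inj (suc i) zero p
  ... | no _  = refl

-- Each `f v` is weighted by the size of the fibre of `e` over `v`. That size is at most 1 if `e` is
-- injective, and at least 1 on the image of `e`; the two inequalities below follow.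
∑-reindex : (e : Fin N → Fin n) (f : Fin n → ℕ) →
  ∑ (f ∘ e) ≡ ∑ (λ v → f v * ∑ (λ i → δ (e i) v))
∑-reindex e f = begin
  ∑ (λ i → f (e i))                     ≡⟨ ∑-cong (λ i → ≡-sym (∑-δ (e i) f)) ⟩
  ∑ (λ i → ∑ (λ v → δ (e i) v * f v))   ≡⟨ ∑-swap (λ i v → δ (e i) v * f v) ⟩
  ∑ (λ v → ∑ (λ i → δ (e i) v * f v))   ≡⟨ ∑-cong (λ v → ∑-cong (λ i → *-comm (δ (e i) v) (f v))) ⟩
  ∑ (λ v → ∑ (λ i → f v * δ (e i) v))   ≡⟨ ∑-cong (λ v → ∑-* (f v) (λ i → δ (e i) v)) ⟩
  ∑ (λ v → f v * ∑ (λ i → δ (e i) v))   ∎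
  where open ≡-Reasoning

∑-injective : (e : Fin N → Fin n) → Injective e → (f : Fin n → ℕ) → ∑ (f ∘ e) ≤ ∑ f
∑-injective e inj f rewrite ∑-reindex e f = ∑-mono λ v →
  ≤-trans (*-monoʳ-≤ (f v) (∑-δ-injective e inj v)) (≤-reflexive (*-identityʳ (f v)))

∑-image : (e : Fin N → Fin n) (f : Fin n → ℕ) →
  (∀ v → 1 ≤ f v → ∃[ i ] e i ≡ v) → ∑ f ≤ ∑ (f ∘ e)
∑-image {N} e f supp rewrite ∑-reindex e f = ∑-mono pointwise
  where
  pointwise : ∀ v → f v ≤ f v * ∑ (λ i → δ (e i) v)
  pointwise v with f v in eq
  ... | zero  = z≤n
  ... | suc x with supp v (subst (1 ≤_) (≡-sym eq) (s≤s z≤n))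
  ... | i , refl = ≤-trans (≤-reflexive (≡-sym (*-identityʳ (suc x))))
    (*-monoʳ-≤ (suc x) (≤-trans (≤-reflexive (≡-sym (δ-refl (e i)))) (term≤∑ (λ j → δ (e j) (e i)) i)))

∷-injective : {A : Set} {x : A} {f : Fin n → A} → (∀ i → x ≢ f i) →
  (∀ i j → f i ≡ f j → i ≡ j) → ∀ i j → (x ∷ f) i ≡ (x ∷ f) j → i ≡ j
∷-injective x∉f inj zero    zero    _ = refl
∷-injective x∉f inj zero    (suc j) p = ⊥-elim (x∉f j p)
∷-injective x∉f inj (suc i) zero    p = ⊥-elim (x∉f i (≡-sym p))
∷-injective x∉f inj (suc i) (suc j) p = cong suc (inj i j p)

pick : (f : Fin n → Bool) → ∀ r → r ≤ ∑ (ι ∘ f) →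
  Σ (Fin r → Fin n) λ g → Injective g × (∀ i → f (g i) ≡ true)
pick f zero    _ = (λ ()) , (λ ()) , (λ ())
pick {zero}  f (suc r) ()
pick {suc n} f (suc r) h rewrite ∑-suc (ι ∘ f) with f zero in eq
... | false with g , inj , hit ← pick (f ∘ suc) (suc r) h =
  suc ∘ g , (λ i j p → inj i j (suc-injective p)) , hit
... | true with g , inj , hit ← pick (f ∘ suc) r (s≤s⁻¹ h) =
  zero ∷ (suc ∘ g) , ∷-injective (λ _ ()) (λ i j p → inj i j (suc-injective p)) ,
  λ { zero → eq ; (suc i) → hit i }

two≤∑ : (f : Fin n → Bool) → ∀ {x y} → x ≢ y → f x ≡ true → f y ≡ true → 2 ≤ ∑ (ι ∘ f)
two≤∑ f {x} {y} x≢y fx fy = subst (_≤ ∑ (ι ∘ f)) (cong₂ (λ a b → ι a + (ι b + 0)) fx fy)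
  (∑-injective (x ∷ λ (_ : Fin 1) → y) (∷-injective (λ _ → x≢y) λ { zero zero _ → refl }) (ι ∘ f))

-- Edge counts and degree sums.

BRel : ℕ → Set
BRel n = Fin n → Fin n → Bool

Symmetric : BRel n → Set
Symmetric X = ∀ i j → X i j ≡ X j i

ordered : BRel n → ℕ
ordered X = ∑ λ i → ∑ λ j → ι (X i j)

-- For the relation `missing G S` this unfolds to `deleted G S`, so bounds on `edges` are bounds on
-- `deleted`.
edges : BRel n → ℕ
edges X = ∑ λ i → ∑ λ j → ι ((toℕ i <ᵇ toℕ j) ∧ X i j)

edges-cover : (X Y Z : BRel n) → (∀ i j → ι (X i j) ≤ ι (Y i j) + ι (Z i j)) →
  edges X ≤ edges Y + edges Z
edges-cover X Y Z h = begin
  edges X ≤⟨ ∑-mono (λ i → ∑-mono (λ j → pointwise (toℕ i <ᵇ toℕ j) i j)) ⟩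
  ∑ (λ i → ∑ (λ j → y i j + z i j))  ≡⟨ ∑-cong (λ i → ∑-+ (y i) (z i)) ⟩
  ∑ (λ i → ∑ (y i) + ∑ (z i))        ≡⟨ ∑-+ (λ i → ∑ (y i)) (λ i → ∑ (z i)) ⟩
  edges Y + edges Z ∎
  where
  open ≤-Reasoning
  y z : Fin _ → Fin _ → ℕ
  y i j = ι ((toℕ i <ᵇ toℕ j) ∧ Y i j)
  z i j = ι ((toℕ i <ᵇ toℕ j) ∧ Z i j)
  pointwise : ∀ b i j → ι (b ∧ X i j) ≤ ι (b ∧ Y i j) + ι (b ∧ Z i j)
  pointwise true  i j = h i j
  pointwise false i j = z≤n

edges-disjoint : (X Y Z : BRel n) → (∀ i j → ι (Y i j) + ι (Z i j) ≤ ι (X i j)) →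
  edges Y + edges Z ≤ edges X
edges-disjoint X Y Z h = begin
  edges Y + edges Z ≡⟨ ≡-sym (∑-+ (λ i → ∑ (y i)) (λ i → ∑ (z i))) ⟩
  ∑ (λ i → ∑ (y i) + ∑ (z i))        ≡⟨ ∑-cong (λ i → ≡-sym (∑-+ (y i) (z i))) ⟩
  ∑ (λ i → ∑ (λ j → y i j + z i j))  ≤⟨ ∑-mono (λ i → ∑-mono (λ j → pointwise (toℕ i <ᵇ toℕ j) i j)) ⟩
  edges X ∎
  where
  open ≤-Reasoning
  y z : Fin _ → Fin _ → ℕ
  y i j = ι ((toℕ i <ᵇ toℕ j) ∧ Y i j)
  z i j = ι ((toℕ i <ᵇ toℕ j) ∧ Z i j)
  pointwise : ∀ b i j → ι (b ∧ Y i j) + ι (b ∧ Z i j) ≤ ι (b ∧ X i j)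
  pointwise true  i j = h i j
  pointwise false i j = z≤n

-- Exactly one order of two distinct indices is increasing. Unlike `edges`, `ordered` does not
-- depend on the numbering of the vertices, which suits degree sums and sums along embeddings.
ordered≡2*edges : (X : BRel n) → Symmetric X → (∀ i → X i i ≡ false) → ordered X ≡ 2 * edges X
ordered≡2*edges X X-sym X-irr = begin
  ∑ (λ i → ∑ (λ j → ι (X i j)))                ≡⟨ ∑-cong (λ i → ∑-cong (pointwise i)) ⟩
  ∑ (λ i → ∑ (λ j → up i j + up j i))          ≡⟨ ∑-cong (λ i → ∑-+ (up i) (λ j → up j i)) ⟩
  ∑ (λ i → ∑ (up i) + ∑ (λ j → up j i))        ≡⟨ ∑-+ (λ i → ∑ (up i)) (λ i → ∑ (λ j → up j i)) ⟩
  edges X + ∑ (λ i → ∑ (λ j → up j i))         ≡⟨ cong (edges X +_) (∑-swap (λ i j → up j i)) ⟩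
  edges X + edges X                            ≡⟨ cong (edges X +_) (≡-sym (+-identityʳ _)) ⟩
  2 * edges X                                  ∎
  where
  open ≡-Reasoning
  up : Fin _ → Fin _ → ℕ
  up i j = ι ((toℕ i <ᵇ toℕ j) ∧ X i j)
  lt : ∀ {a b} → (a <ᵇ b) ≡ true → a < b
  lt {a} {b} p = <ᵇ⇒< a b (Equivalence.from T-≡ p)
  ge : ∀ {a b} → (a <ᵇ b) ≡ false → b ≤ a
  ge {a} {b} p = ≮⇒≥ λ a<b → case-false (trans (≡-sym p) (Equivalence.to T-≡ (<⇒<ᵇ a<b)))
    where
    case-false : ¬ (false ≡ true)
    case-false ()
  pointwise : ∀ i j → ι (X i j) ≡ up i j + up j i
  pointwise i j with toℕ i <ᵇ toℕ j in p | toℕ j <ᵇ toℕ i in q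
  ... | true  | true  = ⊥-elim (<-asym (lt {toℕ i} {toℕ j} p) (lt q))
  ... | true  | false = ≡-sym (+-identityʳ _)
  ... | false | true  = cong ι (X-sym i j)
  ... | false | false with refl ← toℕ-injective {i = i} {j = j} (≤-antisym (ge {toℕ j} {toℕ i} q) (ge p)) = cong ι (X-irr i)

1≤edges : (X : BRel n) → Symmetric X → (∀ i → X i i ≡ false) → ∀ {i j} → X i j ≡ true → 1 ≤ edges X
1≤edges X X-sym X-irr {i} {j} Xij with edges X | ordered≡2*edges X X-sym X-irr
... | suc _ | _  = s≤s z≤n
... | zero  | eq = ⊥-elim (1+n≰n (begin
  1                      ≡⟨ cong ι (≡-sym Xij) ⟩
  ι (X i j)              ≤⟨ term≤∑ (λ j → ι (X i j)) j ⟩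
  ∑ (λ j → ι (X i j))    ≤⟨ term≤∑ (λ i → ∑ (λ j → ι (X i j))) i ⟩
  ordered X              ≡⟨ eq ⟩
  0 ∎))
  where open ≤-Reasoning

touched : BRel n → Fin n → Bool
touched X x = does (any? λ y → X x y ≟ᵇ true)

touched-intro : (X : BRel n) → ∀ {x y} → X x y ≡ true → touched X x ≡ true
touched-intro X {x} {y} p with any? (λ y → X x y ≟ᵇ true)
... | yes _ = refl
... | no ¬q = ⊥-elim (¬q (y , p))

touched-elim : (X : BRel n) → ∀ {x} → touched X x ≡ true → ∃[ y ] X x y ≡ true
touched-elim X {x} p with any? (λ y → X x y ≟ᵇ true)
... | yes q = q

∑-touched : (X : BRel n) → ∑ (ι ∘ touched X) ≤ ordered X
∑-touched X = ∑-mono λ x → ι-≤ (touched X x) λ p → let y , Xxy = touched-elim X p in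
  ≤-trans (≤-reflexive (cong ι (≡-sym Xxy))) (term≤∑ (λ y → ι (X x y)) y)

-- Each ordered edge is charged to an endpoint in `V`; a vertex is charged at most `d` times as
-- first and at most `d` times as second endpoint.
ordered-incident : ∀ A (V : Fin (size A) → Bool) d → (∀ v → V v ≡ true → degree A v ≤ d) →
  ordered (λ x y → adj A x y ∧ (V x ∨ V y)) ≤ 2 * (d * ∑ (ι ∘ V))
ordered-incident A V d deg≤d = begin
  ordered (λ x y → adj A x y ∧ (V x ∨ V y))
    ≤⟨ ∑-mono (λ x → ∑-mono (λ y → pointwise (adj A x y) (V x) (V y))) ⟩
  ∑ (λ x → ∑ (λ y → a x y + b x y))
    ≡⟨ ∑-cong (λ x → ∑-+ (a x) (b x)) ⟩
  ∑ (λ x → ∑ (a x) + ∑ (b x))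
    ≡⟨ ∑-+ (λ x → ∑ (a x)) (λ x → ∑ (b x)) ⟩
  ∑ (λ x → ∑ (a x)) + ∑ (λ x → ∑ (b x))
    ≡⟨ cong (∑ (λ x → ∑ (a x)) +_) (∑-swap b) ⟩
  ∑ (λ x → ∑ (a x)) + ∑ (λ y → ∑ (λ x → b x y))
    ≡⟨ cong (∑ (λ x → ∑ (a x)) +_) (∑-cong (λ y → ∑-cong (λ x →
         cong (λ c → ι (V y) * ι c) (Graph.sym A x y)))) ⟩
  ∑ (λ x → ∑ (a x)) + ∑ (λ x → ∑ (a x))
    ≤⟨ +-mono-≤ half half ⟩
  d * ∑ (ι ∘ V) + d * ∑ (ι ∘ V)
    ≡⟨ cong (d * ∑ (ι ∘ V) +_) (≡-sym (+-identityʳ _)) ⟩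
  2 * (d * ∑ (ι ∘ V)) ∎
  where
  open ≤-Reasoning
  a b : Fin (size A) → Fin (size A) → ℕ
  a x y = ι (V x) * ι (adj A x y)
  b x y = ι (V y) * ι (adj A x y)
  pointwise : ∀ p q r → ι (p ∧ (q ∨ r)) ≤ ι q * ι p + ι r * ι p
  pointwise false q     r     = z≤n
  pointwise true  true  r     = s≤s z≤n
  pointwise true  false true  = s≤s z≤n
  pointwise true  false false = z≤n
  bound : ∀ x → ι (V x) * degree A x ≤ d * ι (V x)
  bound x with V x in eq
  ... | false = z≤n
  ... | true  = ≤-trans (≤-reflexive (+-identityʳ _)) (≤-trans (deg≤d x eq) (≤-reflexive (≡-sym (*-identityʳ d))))
  half : ∑ (λ x → ∑ (a x)) ≤ d * ∑ (ι ∘ V)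
  half = begin
    ∑ (λ x → ∑ (a x))               ≡⟨ ∑-cong (λ x → ∑-* (ι (V x)) (λ y → ι (adj A x y))) ⟩
    ∑ (λ x → ι (V x) * degree A x)  ≤⟨ ∑-mono bound ⟩
    ∑ (λ x → d * ι (V x))           ≡⟨ ∑-* d (ι ∘ V) ⟩
    d * ∑ (ι ∘ V)                   ∎

-- Booleans, walks and induced embeddings.

true≢false : ∀ {b} → b ≡ true → b ≢ false
true≢false refl ()

not-true : ∀ {b} → not b ≡ true → b ≡ false
not-true {false} _ = refl

≢true : ∀ {b} → b ≢ true → b ≡ false
≢true {false} _ = refl
≢true {true}  h = ⊥-elim (h refl)

≡-ext : ∀ {b c} → (b ≡ true → c ≡ true) → (c ≡ true → b ≡ true) → b ≡ c
≡-ext {false} {false} f g = refl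
≡-ext {false} {true}  f g = g refl
≡-ext {true}          f g = ≡-sym (f refl)

∨-true : ∀ {b c} → b ∨ c ≡ true → b ≡ true ⊎ c ≡ true
∨-true {true}  p = inj₁ refl
∨-true {false} p = inj₂ p

∨-false : ∀ {b c} → b ∨ c ≡ false → b ≡ false × c ≡ false
∨-false {false} p = refl , p

does⇒ : ∀ {P : Set} (P? : Dec P) → does P? ≡ true → P
does⇒ (yes p) _ = p

walk-map : (f : Fin (size F) → Fin (size G)) →
  (∀ a b → adj F a b ≡ true → adj G (f a) (f b) ≡ true) →
  ∀ {u v ℓ} → Walk F u v ℓ → Walk G (f u) (f v) ℓ
walk-map f h here       = here
walk-map f h (step p w) = step (h _ _ p) (walk-map f h w)

walk-emb : (e : InducedEmb F G) → ∀ {u v ℓ} → Walk F u v ℓ → Walk G (emb e u) (emb e v) ℓ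
walk-emb e = walk-map (emb e) (λ a b p → trans (emb-adj e a b) p)

_++ʷ_ : ∀ {u v w ℓ ℓ′} → Walk G u v ℓ → Walk G v w ℓ′ → Walk G u w (ℓ + ℓ′)
here     ++ʷ w′ = w′
step p w ++ʷ w′ = step p (w ++ʷ w′)

_∘ᵉ_ : InducedEmb G H → InducedEmb F G → InducedEmb F H
f ∘ᵉ e = record
  { emb     = emb f ∘ emb e
  ; emb-inj = λ i j p → emb-inj e i j (emb-inj f _ _ p)
  ; emb-adj = λ i j → trans (emb-adj f _ _) (emb-adj e i j)
  }

InVH-emb : ∀ {ℋ} (e : InducedEmb F G) → ∀ {u} → InVH ℋ F u → InVH ℋ G (emb e u)
InVH-emb e (F , F∈ℋ , c , i , refl) = F , F∈ℋ , e ∘ᵉ c , i , refl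

HasClique-emb : ∀ {t} → InducedEmb F G → HasClique F t → HasClique G t
HasClique-emb e (f , inj , full) =
  emb e ∘ f , (λ i j p → inj i j (emb-inj e _ _ p)) , λ i j i≢j → trans (emb-adj e _ _) (full i j i≢j)

-- Deciding whether a copy passes through given vertices.

CopyThrough : List Graph → (G : Graph) → Fin (size G) → Fin (size G) → Set
CopyThrough ℋ G x y = ∃[ F ] (F ∈ ℋ × Σ (InducedEmb F G) λ e →
  (∃[ a ] emb e a ≡ x) × (∃[ b ] emb e b ≡ y))

abstract
  -- The functions are enumerated through their codes. Decoding the code of `f` gives back `f` only
  -- pointwise, which is why `resp` is required.
  Σ-fun? : {P : (Fin m → Fin n) → Set} → (∀ {f g} → (∀ i → f i ≡ g i) → P f → P g) →
    (∀ f → Dec (P f)) → Dec (∃ P)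
  Σ-fun? resp P? = map′ (λ (k , p) → finToFun k , p)
    (λ (f , p) → funToFin f , resp (λ i → ≡-sym (finToFun-funToFin f i)) p)
    (any? (P? ∘ finToFun))

  copyThrough? : ∀ ℋ G x y → Dec (CopyThrough ℋ G x y)
  copyThrough? ℋ G x y = map′ find (λ (F , F∈ℋ , p) → lose F∈ℋ p) (Any.any? copy? ℋ)
    where
    IsCopy : ∀ F → (Fin (size F) → Fin (size G)) → Set
    IsCopy F f = (Injective f × (∀ i j → adj G (f i) (f j) ≡ adj F i j)) ×
      ((∃[ a ] f a ≡ x) × (∃[ b ] f b ≡ y))
    isCopy? : ∀ F f → Dec (IsCopy F f)
    isCopy? F f =
      (all? (λ i → all? λ j → (f i ≟ f j) →-dec (i ≟ j)) ×-dec
       all? (λ i → all? λ j → adj G (f i) (f j) ≟ᵇ adj F i j)) ×-dec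
      (any? (λ a → f a ≟ x) ×-dec any? (λ b → f b ≟ y))
    resp : ∀ F {f g} → (∀ i → f i ≡ g i) → IsCopy F f → IsCopy F g
    resp F f≗g ((inj , pres) , (a , fa) , (b , fb)) =
      ((λ i j p → inj i j (trans (f≗g i) (trans p (≡-sym (f≗g j))))) ,
       (λ i j → trans (≡-sym (cong₂ (adj G) (f≗g i) (f≗g j))) (pres i j))) ,
      (a , trans (≡-sym (f≗g a)) fa) , (b , trans (≡-sym (f≗g b)) fb)
    copy? : ∀ F → Dec (Σ (InducedEmb F G) λ e → (∃[ a ] emb e a ≡ x) × (∃[ b ] emb e b ≡ y))
    copy? F = map′
      (λ (f , (inj , pres) , ends) → record { emb = f ; emb-inj = inj ; emb-adj = pres } , ends)
      (λ (e , ends) → emb e , (emb-inj e , emb-adj e) , ends)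
      (Σ-fun? (resp F) (isCopy? F))

  inVH? : ∀ ℋ G v → Dec (InVH ℋ G v)
  inVH? ℋ G v = map′ (λ (F , F∈ℋ , e , p , _) → F , F∈ℋ , e , p)
    (λ (F , F∈ℋ , e , p) → F , F∈ℋ , e , p , p) (copyThrough? ℋ G v v)

-- Deleted edges, and copies before and after deletion.

missing : (G : Graph) → SpanningSub G → BRel (size G)
missing G S x y = adj G x y ∧ not (sadj S x y)

missing-sym : ∀ G S → Symmetric (missing G S)
missing-sym G S x y = cong₂ (λ a b → a ∧ not b) (Graph.sym G x y) (ssym S x y)

missing-irrefl : ∀ G S x → missing G S x x ≡ false
missing-irrefl G S x = cong (_∧ not (sadj S x x)) (irrefl G x)

remove : (G : Graph) (X : BRel (size G)) → Symmetric X → SpanningSub G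
remove G X X-sym = record
  { sadj    = λ i j → adj G i j ∧ not (X i j)
  ; ssym    = λ i j → cong₂ (λ a b → a ∧ not b) (Graph.sym G i j) (X-sym i j)
  ; sirrefl = λ i → cong (_∧ not (X i i)) (irrefl G i)
  ; ssub    = λ i j → ∧-conicalˡ _ _
  }

missing-remove : ∀ G X X-sym {x y} → missing G (remove G X X-sym) x y ≡ true → X x y ≡ true
missing-remove G X X-sym {x} {y} p with adj G x y | X x y
... | true | true = refl

missing-intro : ∀ G S {x y} → adj G x y ≡ true → sadj S x y ≡ false → missing G S x y ≡ true
missing-intro G S p q = cong₂ (λ a b → a ∧ not b) p q

missing-elim : ∀ G S {x y} → missing G S x y ≡ true → sadj S x y ≡ false
missing-elim G S {x} {y} p = not-true (∧-conicalʳ (adj G x y) _ p)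

sadj≡adj : ∀ G S {x y} → missing G S x y ≢ true → sadj S x y ≡ adj G x y
sadj≡adj G S {x} {y} h = ≡-ext (ssub S x y) λ p → decide (sadj S x y) refl p
  where
  decide : ∀ b → sadj S x y ≡ b → adj G x y ≡ true → b ≡ true
  decide true  _ _ = refl
  decide false q p = ⊥-elim (h (missing-intro G S p q))

MeetsMissing : (G : Graph) (S : SpanningSub G) → (Fin m → Fin (size G)) → Set
MeetsMissing G S f = ∃[ a ] ∃[ b ] missing G S (f a) (f b) ≡ true

meetsMissing? : ∀ G S (f : Fin m → Fin (size G)) → Dec (MeetsMissing G S f)
meetsMissing? G S f = any? λ a → any? λ b → missing G S (f a) (f b) ≟ᵇ true

-- Both adjacencies agree on pairs that are not missing. The pointwise equality is returned so that
-- the original vertices can be placed in V_H.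
copy-of-sub : ∀ S (c : InducedEmb F (subGraph G S)) → ¬ MeetsMissing G S (emb c) →
  Σ (InducedEmb F G) λ c′ → ∀ a → emb c′ a ≡ emb c a
copy-of-sub {G = G} S c none = record
  { emb     = emb c
  ; emb-inj = emb-inj c
  ; emb-adj = λ a b → trans (≡-sym (sadj≡adj G S (λ p → none (a , b , p)))) (emb-adj c a b)
  } , λ _ → refl

copy-in-sub : ∀ S (c : InducedEmb F G) → ¬ MeetsMissing G S (emb c) → InducedEmb F (subGraph G S)
copy-in-sub {G = G} S c none = record
  { emb     = emb c
  ; emb-inj = emb-inj c
  ; emb-adj = λ a b → trans (sadj≡adj G S (λ p → none (a , b , p))) (emb-adj c a b)
  }

walk-sub : ∀ S (c : InducedEmb F (subGraph G S)) → ∀ {a b ℓ} → Walk F a b ℓ → Walk G (emb c a) (emb c b) ℓ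
walk-sub {G = G} S c = walk-map {G = G} (emb c) λ a b p → ssub S _ _ (trans (emb-adj c a b) p)

-- Consequences of the Ramsey property.

-- The Ramsey property is applied to `R` neighbours of `v`. Independent neighbours form a star
-- centred at `v`; a clique of order `t` among them grows by `v` to the forbidden order.
big-degree-star : ∀ {s t R} → RamseyProp s t R → ∀ G → ¬ HasClique G (suc t) →
  ∀ v → R ≤ degree G v → Σ (InducedEmb (star s) G) λ e → emb e zero ≡ v
big-degree-star {s} {t} {R} ramsey G no-clique v R≤deg
  with g , g-inj , g-adj ← pick (adj G v) R R≤deg
  with ramsey (record { size = R ; adj = λ i j → adj G (g i) (g j)
                      ; sym = λ i j → Graph.sym G _ _ ; irrefl = λ i → irrefl G _ }) refl
... | inj₁ (f , f-inj , indep) = record { emb = e ; emb-inj = e-inj ; emb-adj = e-adj } , refl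
  where
  e : Fin (suc s) → Fin (size G)
  e = v ∷ (g ∘ f)
  e-inj : Injective e
  e-inj = ∷-injective (λ i v≡gfi → true≢false (g-adj (f i)) (trans (cong (adj G v) (≡-sym v≡gfi)) (irrefl G v)))
    λ i j p → f-inj i j (g-inj _ _ p)
  e-adj : ∀ i j → adj G (e i) (e j) ≡ starAdj s i j
  e-adj zero    zero    = irrefl G v
  e-adj zero    (suc j) = g-adj _
  e-adj (suc i) zero    = trans (Graph.sym G _ _) (g-adj _)
  e-adj (suc i) (suc j) with i ≟ j
  ... | yes refl = irrefl G _
  ... | no i≢j   = indep i j i≢j
... | inj₂ (f , f-inj , full) = ⊥-elim (no-clique (e , e-inj , e-full))
  where
  e : Fin (suc t) → Fin (size G)
  e = v ∷ (g ∘ f)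
  e-inj : Injective e
  e-inj = ∷-injective (λ i v≡gfi → true≢false (g-adj (f i)) (trans (cong (adj G v) (≡-sym v≡gfi)) (irrefl G v)))
    λ i j p → f-inj i j (g-inj _ _ p)
  e-full : ∀ i j → i ≢ j → adj G (e i) (e j) ≡ true
  e-full zero    zero    i≢j = ⊥-elim (i≢j refl)
  e-full zero    (suc j) _   = g-adj _
  e-full (suc i) zero    _   = trans (Graph.sym G _ _) (g-adj _)
  e-full (suc i) (suc j) i≢j = full i j (i≢j ∘ cong suc)

-- Tested on the edgeless graph with `R` vertices, which has no clique of order 2.
RamseyProp⇒s≤R : ∀ {s t R} → 2 ≤ t → RamseyProp s t R → s ≤ R
RamseyProp⇒s≤R {s} {t@(suc (suc _))} {R} _ ramsey
  with ramsey (record { size = R ; adj = λ _ _ → false ; sym = λ _ _ → refl ; irrefl = λ _ → refl }) refl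
... | inj₁ (f , f-inj , _) = injective⇒≤ {f = f} (λ {i} {j} → f-inj i j)
... | inj₂ (f , _ , full) with () ← full zero (suc zero) (λ ())
RamseyProp⇒s≤R {t = suc zero} (s≤s ()) _

-- Layers of deleted edges and the exchange argument.

module Layers
  (ℋ : List Graph) (D : ℕ)
  (diam : ∀ F → F ∈ ℋ → ∀ u v → ∃[ ℓ ] (ℓ ≤ D × Walk F u v ℓ))
  (k d : ℕ) (1≤d : 1 ≤ d)
  (A : Graph) (small-degree : ∀ v → ¬ InVH ℋ A v → degree A v ≤ d)
  where

  private
    q = 2 * d ∸ 1

    V = Fin (size A)

  suc-q : suc q ≡ 2 * d
  suc-q = trans (+-comm 1 q) (m∸n+n≡m (≤-trans 1≤d (m≤m+n d _)))

  Within : ℕ → V → Set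
  Within r z = ∃[ u ] (InVH ℋ A u × ∃[ ℓ ] (Walk A z u ℓ × ℓ ≤ r))

  -- Layer j ≥ 1 is formed only if layer j - 1 left edges over, whence b^(j-1) ≤ k.
  Near : V → Set
  Near z = ∃[ j ] (Within (j * D) z × (2 * d) ^ (j ∸ 1) ≤ k * q ^ (j ∸ 1))

  NearSolution : SpanningSub A → Set
  NearSolution S = ∀ x y → missing A S x y ≡ true → Near x ⊎ Near y

  Better : SpanningSub A → Set
  Better S = ∃[ S′ ] (deleted A S′ < deleted A S × Free ℋ (subGraph A S′))

  module Layer (S : SpanningSub A) (free : Free ℋ (subGraph A S))
    (C : BRel (size A)) (C-sym : Symmetric C)
    (C⊆E : ∀ x y → C x y ≡ true → missing A S x y ≡ true)
    (VH⊆C : ∀ x y → missing A S x y ≡ true → InVH ℋ A x → C x y ≡ true)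
    where

    E : BRel (size A)
    E = missing A S

    R : SpanningSub A
    R = remove A C C-sym

    A∖C : Graph
    A∖C = subGraph A R

    -- With `C` the union of the layers so far, `A∖C` still contains all edges of `rest`; `next` is
    -- the part of them whose two ends share a copy there.
    rest next : BRel (size A)
    rest x y = E x y ∧ not (C x y)
    next x y = E x y ∧ (not (C x y) ∧ does (copyThrough? ℋ A∖C x y))

    rest⇒E : ∀ {x y} → rest x y ≡ true → E x y ≡ true
    rest⇒E = ∧-conicalˡ _ _

    rest⇒¬C : ∀ {x y} → rest x y ≡ true → C x y ≡ false
    rest⇒¬C {x} {y} p = not-true (∧-conicalʳ (E x y) _ p)

    rest-sym : Symmetric rest
    rest-sym x y = cong₂ (λ a b → a ∧ not b) (missing-sym A S x y) (C-sym x y)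

    rest-irrefl : ∀ x → rest x x ≡ false
    rest-irrefl x = cong (_∧ not (C x x)) (missing-irrefl A S x)

    next⇒rest : ∀ {x y} → next x y ≡ true → rest x y ≡ true
    next⇒rest {x} {y} p = cong₂ _∧_ (∧-conicalˡ (E x y) _ p)
      (∧-conicalˡ (not (C x y)) _ (∧-conicalʳ (E x y) _ p))

    next⇒copy : ∀ {x y} → next x y ≡ true → CopyThrough ℋ A∖C x y
    next⇒copy {x} {y} p = does⇒ (copyThrough? ℋ A∖C x y)
      (∧-conicalʳ (not (C x y)) _ (∧-conicalʳ (E x y) _ p))

    copy⇒next : ∀ {x y} → rest x y ≡ true → CopyThrough ℋ A∖C x y → next x y ≡ true
    copy⇒next {x} {y} p c = cong₂ _∧_ (∧-conicalˡ (E x y) _ p)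
      (cong₂ _∧_ (∧-conicalʳ (E x y) _ p) (dec-true (copyThrough? ℋ A∖C x y) c))

    next-sym : Symmetric next
    next-sym x y = ≡-ext (flip x y) (flip y x)
      where
      flip : ∀ x y → next x y ≡ true → next y x ≡ true
      flip x y p with F , F∈ℋ , c , px , py ← next⇒copy p =
        copy⇒next (trans (rest-sym y x) (next⇒rest p)) (F , F∈ℋ , c , py , px)

    next-irrefl : ∀ x → next x x ≡ false
    next-irrefl x = cong (_∧ (not (C x x) ∧ does (copyThrough? ℋ A∖C x x))) (missing-irrefl A S x)

    -- The copy through the edge spans an edge of `C`, one end of which is within `r` of V_H, and
    -- its diameter adds at most `D`. If it spanned none it would be a copy in `A`, so `x` would be
    -- in V_H and the edge already in `C`.
    next-within : ∀ {r} → (∀ x y → C x y ≡ true → Within r x ⊎ Within r y) →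
      ∀ x y → next x y ≡ true → Within (D + r) x
    next-within {r} C-near x y p = through (next⇒copy p)
      where
      extend : ∀ {F} → F ∈ ℋ → (c : InducedEmb F A∖C) → ∀ a z →
        Within r (emb c z) → Within (D + r) (emb c a)
      extend F∈ℋ c a z (u , u∈VH , ℓ , w , ℓ≤) with ℓ′ , ℓ′≤ , w′ ← diam _ F∈ℋ a z =
        u , u∈VH , ℓ′ + ℓ , walk-sub R c w′ ++ʷ w , +-mono-≤ ℓ′≤ ℓ≤
      through : CopyThrough ℋ A∖C x y → Within (D + r) x
      through (F , F∈ℋ , c , (a , refl) , _) with meetsMissing? A R (emb c)
      ... | yes (a′ , b′ , Cab) with C-near _ _ (missing-remove A C C-sym Cab)
      ...   | inj₁ near = extend F∈ℋ c a a′ near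
      ...   | inj₂ near = extend F∈ℋ c a b′ near
      through (F , F∈ℋ , c , (a , refl) , _) | no none with c′ , same ← copy-of-sub {G = A} R c none =
        ⊥-elim (true≢false (VH⊆C x y (rest⇒E (next⇒rest p)) (F , F∈ℋ , c′ , a , same a))
          (rest⇒¬C (next⇒rest p)))

    hit : V → Bool
    hit = touched next

    isolate : BRel (size A)
    isolate x y = C x y ∨ (hit x ∨ hit y)

    -- The exchange: `C` stays deleted, the endpoints of `next` become isolated, and all other edges
    -- are restored.
    S′ : SpanningSub A
    S′ = remove A isolate λ x y → cong₂ _∨_ (C-sym x y) (∨-comm (hit x) (hit y))

    module _ {F : Graph} (F∈ℋ : F ∈ ℋ) (c : InducedEmb F (subGraph A S′)) where

      S′⇒ : ∀ {x y} → sadj S′ x y ≡ true →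
        adj A x y ≡ true × C x y ≡ false × hit x ≡ false
      S′⇒ {x} {y} p with not-isolated ← ∨-false {C x y} (not-true (∧-conicalʳ (adj A x y) _ p)) =
        ∧-conicalˡ _ _ p , proj₁ not-isolated , proj₁ (∨-false (proj₂ not-isolated))

      -- The walk in `F` from `x` to `y` starts with an edge at `x`, whereas hit vertices are
      -- isolated.
      unhit : ∀ x y → x ≢ y → hit (emb c x) ≡ false
      unhit x y x≢y with diam F F∈ℋ x y
      ... | _ , _ , here     = ⊥-elim (x≢y refl)
      ... | _ , _ , step p _ = proj₂ (proj₂ (S′⇒ (trans (emb-adj c x _) p)))

      S′⇐ : ∀ {x y} → hit x ≡ false → hit y ≡ false → adj A x y ≡ true → C x y ≡ false →
        sadj S′ x y ≡ true
      S′⇐ hx hy p q rewrite hx | hy | p | q = refl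

      -- A copy that spans an edge of `rest` avoids all hit vertices, hence is a copy in `A∖C`; that
      -- edge is then in `next` and its ends are hit. On a copy that spans no such edge, `S` and
      -- `S′` agree, against `free`.
      no-copy : ⊥
      no-copy with any? (λ a → any? λ b → rest (emb c a) (emb c b) ≟ᵇ true)
      ... | yes (a , b , rest-ab) = true≢false (touched-intro next next-ab) (all-unhit a)
        where
        all-unhit : ∀ x → hit (emb c x) ≡ false
        all-unhit x with x ≟ a
        ... | no x≢a   = unhit x a x≢a
        -- For `a` itself the other vertex is `b`, distinct from `a` because `rest` is irreflexive.
        ... | yes refl = unhit a b λ { refl → true≢false rest-ab (rest-irrefl _) }
        c′ : InducedEmb F A∖C
        c′ = record
          { emb     = emb c
          ; emb-inj = emb-inj c
          ; emb-adj = λ i j → trans (≡-ext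
              (λ p → S′⇐ (all-unhit i) (all-unhit j) (∧-conicalˡ _ _ p)
                (not-true (∧-conicalʳ (adj A (emb c i) (emb c j)) _ p)))
              (λ p → let Aij , ¬Cij , _ = S′⇒ p in cong₂ (λ a b → a ∧ not b) Aij ¬Cij)) (emb-adj c i j)
          }
        next-ab : next (emb c a) (emb c b) ≡ true
        next-ab = copy⇒next rest-ab (F , F∈ℋ , c′ , (a , refl) , (b , refl))
      ... | no none = free F F∈ℋ record
          { emb     = emb c
          ; emb-inj = emb-inj c
          ; emb-adj = λ i j → trans (≡-ext (to i j) (from i j)) (emb-adj c i j)
          }
        where
        to : ∀ i j → sadj S (emb c i) (emb c j) ≡ true → sadj S′ (emb c i) (emb c j) ≡ true
        to i j p with i ≟ j
        ... | yes refl = ⊥-elim (true≢false p (sirrefl S _))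
        ... | no i≢j   = S′⇐ (unhit i j i≢j) (unhit j i (i≢j ∘ ≡-sym)) (ssub S _ _ p)
          (≢true λ Cij → true≢false p (missing-elim A S (C⊆E _ _ Cij)))
        from : ∀ i j → sadj S′ (emb c i) (emb c j) ≡ true → sadj S (emb c i) (emb c j) ≡ true
        from i j p with Aij , ¬Cij , _ ← S′⇒ p =
          trans (sadj≡adj A S λ Eij → none (i , j , cong₂ (λ a b → a ∧ not b) Eij ¬Cij)) Aij

    S′-free : Free ℋ (subGraph A S′)
    S′-free F = no-copy

    -- The edges of `next` have at most `2 * edges next` endpoints, each of degree at most `d`.
    S′-size : deleted A S′ ≤ edges C + 2 * d * edges next
    S′-size = ≤-trans (edges-cover (missing A S′) C incident λ x y →
        pointwise (adj A x y) (C x y) (hit x ∨ hit y))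
      (+-monoʳ-≤ (edges C) (*-cancelˡ-≤ 2 (begin
        2 * edges incident           ≡⟨ ≡-sym (ordered≡2*edges incident incident-sym incident-irrefl) ⟩
        ordered incident             ≤⟨ ordered-incident A hit d hit-degree ⟩
        2 * (d * ∑ (ι ∘ hit))        ≤⟨ *-monoʳ-≤ 2 (*-monoʳ-≤ d (∑-touched next)) ⟩
        2 * (d * ordered next)       ≡⟨ cong (λ n → 2 * (d * n)) (ordered≡2*edges next next-sym next-irrefl) ⟩
        2 * (d * (2 * edges next))   ≡⟨ cong (2 *_) (rearrange d (edges next)) ⟩
        2 * (2 * d * edges next)     ∎)))
      where
      open ≤-Reasoning
      incident : BRel (size A)
      incident x y = adj A x y ∧ (hit x ∨ hit y)
      incident-sym : Symmetric incident
      incident-sym x y = cong₂ _∧_ (Graph.sym A x y) (∨-comm (hit x) (hit y))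
      incident-irrefl : ∀ x → incident x x ≡ false
      incident-irrefl x = cong (_∧ (hit x ∨ hit x)) (irrefl A x)
      rearrange : ∀ d n → d * (2 * n) ≡ 2 * d * n
      rearrange = solve-∀
      -- If a hit vertex were in V_H, its edge of `next` would already be in `C`.
      hit-degree : ∀ v → hit v ≡ true → degree A v ≤ d
      hit-degree v p with w , nvw ← touched-elim next p = small-degree v λ v∈VH →
        true≢false (VH⊆C v w (rest⇒E (next⇒rest nvw)) v∈VH) (rest⇒¬C (next⇒rest nvw))
      pointwise : ∀ a c h → ι (a ∧ not (a ∧ not (c ∨ h))) ≤ ι c + ι (a ∧ h)
      pointwise false c     h     = z≤n
      pointwise true  true  h     = s≤s z≤n
      pointwise true  false true  = s≤s z≤n
      pointwise true  false false = z≤n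

    C+rest : edges C + edges rest ≤ deleted A S
    C+rest = edges-disjoint E C rest λ x y → pointwise (E x y) (C x y) (C⊆E x y)
      where
      pointwise : ∀ e c → (c ≡ true → e ≡ true) → ι c + ι (e ∧ not c) ≤ ι e
      pointwise true  true  _ = s≤s z≤n
      pointwise true  false _ = s≤s z≤n
      pointwise false false _ = z≤n
      pointwise false true  h with () ← h refl

    C⁺ : BRel (size A)
    C⁺ x y = C x y ∨ next x y

    rest⁺+next : edges (λ x y → E x y ∧ not (C⁺ x y)) + edges next ≤ edges rest
    rest⁺+next = edges-disjoint rest (λ x y → E x y ∧ not (C⁺ x y)) next λ x y →
      pointwise (E x y) (C x y) (does (copyThrough? ℋ A∖C x y))
      where
      pointwise : ∀ e c t → ι (e ∧ not (c ∨ (e ∧ (not c ∧ t)))) + ι (e ∧ (not c ∧ t)) ≤ ι (e ∧ not c)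
      pointwise false c     t     = z≤n
      pointwise true  true  t     = z≤n
      pointwise true  false true  = s≤s z≤n
      pointwise true  false false = s≤s z≤n

  -- Here `j` is the index of the last layer in `C`. With b = 2d/(2d-1) and r remaining edges, the
  -- numerical invariants are r b^j ≤ k and b^(j ∸ 1) ≤ k, the second being what `Near` records.
  -- Every new layer removes an edge, so `fuel` suffices.
  layers : ∀ S → Free ℋ (subGraph A S) → deleted A S ≤ k → ∀ fuel j C → Symmetric C →
    (∀ x y → C x y ≡ true → missing A S x y ≡ true) →
    (∀ x y → missing A S x y ≡ true → InVH ℋ A x → C x y ≡ true) →
    (∀ x y → C x y ≡ true → Within (j * D) x ⊎ Within (j * D) y) →
    edges (λ x y → missing A S x y ∧ not (C x y)) < fuel →
    edges (λ x y → missing A S x y ∧ not (C x y)) * (2 * d) ^ j ≤ k * q ^ j →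
    (2 * d) ^ (j ∸ 1) ≤ k * q ^ (j ∸ 1) →
    NearSolution S ⊎ Better S
  layers S free S≤k (suc fuel) j C C-sym C⊆E VH⊆C C-near (s≤s rest≤fuel) rest-bound j-bound
    with edges (Layer.rest S free C C-sym C⊆E VH⊆C) ℕ.≟ 0
  ... | yes empty = inj₁ near
    where
    open Layer S free C C-sym C⊆E VH⊆C
    near : NearSolution S
    near x y Exy with C x y in Cxy
    ... | true with C-near x y Cxy
    ...   | inj₁ w = inj₁ (j , w , j-bound)
    ...   | inj₂ w = inj₂ (j , w , j-bound)
    near x y Exy | false = ⊥-elim (<-irrefl (≡-sym empty)
      (1≤edges rest rest-sym rest-irrefl (cong₂ (λ a b → a ∧ not b) Exy Cxy)))
  ... | no nonempty with edges (Layer.rest S free C C-sym C⊆E VH⊆C) ≤?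
                         2 * d * edges (Layer.next S free C C-sym C⊆E VH⊆C)
  -- A next layer with less than 1/(2d) of the remaining edges makes `S′` strictly cheaper than `S`.
  ...   | no ¬≤ = inj₂ (S′ , ≤-<-trans S′-size (<-≤-trans (+-monoʳ-< (edges C) (≰⇒> ¬≤)) C+rest) , S′-free)
    where open Layer S free C C-sym C⊆E VH⊆C
  ...   | yes rest≤next = layers S free S≤k fuel (suc j) C⁺
      (λ x y → cong₂ _∨_ (C-sym x y) (next-sym x y))
      C⁺⊆E (λ x y p v → cong (_∨ next x y) (VH⊆C x y p v)) C⁺-near
      -- Since edges remain, `rest-bound` at `j` already gives the bound with exponent `suc j ∸ 1`.
      (<-≤-trans fewer rest≤fuel) bound⁺ (≤-trans (m≤n*m _ (edges rest) {{≢-nonZero nonempty}}) rest-bound)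
    where
    open Layer S free C C-sym C⊆E VH⊆C
    rest⁺ : ℕ
    rest⁺ = edges (λ x y → E x y ∧ not (C⁺ x y))
    C⁺⊆E : ∀ x y → C⁺ x y ≡ true → E x y ≡ true
    C⁺⊆E x y p with ∨-true {C x y} p
    ... | inj₁ Cxy = C⊆E x y Cxy
    ... | inj₂ nxy = rest⇒E (next⇒rest nxy)
    widen : ∀ z → Within (j * D) z → Within (suc j * D) z
    widen z (u , u∈VH , ℓ , w , ℓ≤) = u , u∈VH , ℓ , w , ≤-trans ℓ≤ (m≤n+m _ D)
    C⁺-near : ∀ x y → C⁺ x y ≡ true → Within (suc j * D) x ⊎ Within (suc j * D) y
    C⁺-near x y p with ∨-true {C x y} p
    ... | inj₂ nxy = inj₁ (next-within C-near x y nxy)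
    ... | inj₁ Cxy with C-near x y Cxy
    ...   | inj₁ w = inj₁ (widen x w)
    ...   | inj₂ w = inj₂ (widen y w)
    fewer : rest⁺ < edges rest
    fewer = <-≤-trans (m<m+n rest⁺ (n≢0⇒n>0 λ next≡0 → nonempty (n≤0⇒n≡0 (≤-trans rest≤next
      (≤-reflexive (trans (cong (2 * d *_) next≡0) (*-zeroʳ (2 * d)))))))) rest⁺+next
    -- Adding `edges rest` to both sides turns the factor 2d-1 on the right into 2d; on the left the
    -- added term is at most 2d times the next layer.
    shrink : 2 * d * rest⁺ ≤ q * edges rest
    shrink = +-cancelʳ-≤ (edges rest) _ _ (begin
      2 * d * rest⁺ + edges rest            ≤⟨ +-monoʳ-≤ _ rest≤next ⟩
      2 * d * rest⁺ + 2 * d * edges next    ≡⟨ ≡-sym (*-distribˡ-+ (2 * d) rest⁺ _) ⟩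
      2 * d * (rest⁺ + edges next)          ≤⟨ *-monoʳ-≤ (2 * d) rest⁺+next ⟩
      2 * d * edges rest                    ≡⟨ cong (_* edges rest) (≡-sym suc-q) ⟩
      edges rest + q * edges rest           ≡⟨ +-comm (edges rest) _ ⟩
      q * edges rest + edges rest           ∎)
      where open ≤-Reasoning
    bound⁺ : rest⁺ * (2 * d) ^ suc j ≤ k * q ^ suc j
    bound⁺ = begin
      rest⁺ * (2 * d * (2 * d) ^ j)   ≡⟨ ≡-sym (*-assoc rest⁺ (2 * d) _) ⟩
      rest⁺ * (2 * d) * (2 * d) ^ j   ≡⟨ cong (_* (2 * d) ^ j) (*-comm rest⁺ (2 * d)) ⟩
      2 * d * rest⁺ * (2 * d) ^ j     ≤⟨ *-monoˡ-≤ ((2 * d) ^ j) shrink ⟩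
      q * edges rest * (2 * d) ^ j    ≡⟨ *-assoc q _ _ ⟩
      q * (edges rest * (2 * d) ^ j)  ≤⟨ *-monoʳ-≤ q rest-bound ⟩
      q * (k * q ^ j)                 ≡⟨ swap q k _ ⟩
      k * (q * q ^ j)                 ∎
      where
      open ≤-Reasoning
      swap : ∀ a b c → a * (b * c) ≡ b * (a * c)
      swap = solve-∀

  -- Descent on the number of deleted edges: every `Better` solution is strictly smaller, so
  -- `layers` finally returns `NearSolution`.
  nearSolution : 1 ≤ k → ∀ fuel S → deleted A S < fuel → deleted A S ≤ k → Free ℋ (subGraph A S) →
    ∃[ S′ ] (deleted A S′ ≤ k × Free ℋ (subGraph A S′) × NearSolution S′)
  nearSolution 1≤k (suc fuel) S (s≤s S≤fuel) S≤k free
    with layers S free S≤k (suc (edges rest)) 0 C C-sym C⊆E VH⊆C C-near ≤-refl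
      (≤-trans (≤-reflexive (*-identityʳ _)) (≤-trans rest≤k (≤-reflexive (≡-sym (*-identityʳ k)))))
      -- At `j` = 0 the exponent is truncated to 0 and the bound reads 1 ≤ k.
      (≤-trans 1≤k (≤-reflexive (≡-sym (*-identityʳ k))))
    where
    inVH : V → Bool
    inVH x = does (inVH? ℋ A x)
    -- Layer 0: the deleted edges with an end in V_H.
    C : BRel (size A)
    C x y = missing A S x y ∧ (inVH x ∨ inVH y)
    C-sym : Symmetric C
    C-sym x y = cong₂ _∧_ (missing-sym A S x y) (∨-comm (inVH x) (inVH y))
    C⊆E : ∀ x y → C x y ≡ true → missing A S x y ≡ true
    C⊆E x y = ∧-conicalˡ _ _
    VH⊆C : ∀ x y → missing A S x y ≡ true → InVH ℋ A x → C x y ≡ true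
    VH⊆C x y p v = cong₂ _∧_ p (cong (_∨ inVH y) (dec-true (inVH? ℋ A x) v))
    C-near : ∀ x y → C x y ≡ true → Within 0 x ⊎ Within 0 y
    C-near x y p with ∨-true {inVH x} (∧-conicalʳ (missing A S x y) _ p)
    ... | inj₁ v = inj₁ (x , does⇒ (inVH? ℋ A x) v , 0 , here , z≤n)
    ... | inj₂ v = inj₂ (y , does⇒ (inVH? ℋ A y) v , 0 , here , z≤n)
    rest : BRel (size A)
    rest x y = missing A S x y ∧ not (C x y)
    rest≤k : edges rest ≤ k
    rest≤k = ≤-trans (m≤n+m _ _) (≤-trans (Layer.C+rest S free C C-sym C⊆E VH⊆C) S≤k)
  ... | inj₁ near = S , S≤k , free , near
  ... | inj₂ (S′ , S′<S , free′) =
    nearSolution 1≤k fuel S′ (<-≤-trans S′<S S≤fuel) (≤-trans (<⇒≤ S′<S) S≤k) free′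

-- Arithmetic of the logarithmic thresholds.

^-distribʳ-* : ∀ m n o → (m * n) ^ o ≡ m ^ o * n ^ o
^-distribʳ-* m n zero    = refl
^-distribʳ-* m n (suc o) rewrite ^-distribʳ-* m n o = interchange m n (m ^ o) (n ^ o)
  where
  interchange : ∀ a b c d → a * b * (c * d) ≡ a * c * (b * d)
  interchange = solve-∀

^-swap : ∀ m n o → (m ^ n) ^ o ≡ (m ^ o) ^ n
^-swap m n o = trans (^-*-assoc m n o) (trans (cong (m ^_) (*-comm n o)) (≡-sym (^-*-assoc m o n)))

^-cancelʳ-≤ : ∀ m n o .{{_ : NonZero o}} → m ^ o ≤ n ^ o → m ≤ n
^-cancelʳ-≤ m n o h = ≮⇒≥ λ n<m → <⇒≱ (^-monoˡ-< o n<m) h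

-- X ≤ D log_b k and D log_b d < a / c give d^(Xc) ≤ k^a, as both are compared with b^(aX).
d^X≤k^a : ∀ d D k q X a c .{{_ : NonZero D}} .{{_ : NonZero q}} →
  (2 * d) ^ X ≤ k ^ D * q ^ X → d ^ (D * c) * q ^ a < (2 * d) ^ a → d ^ (X * c) ≤ k ^ a
d^X≤k^a d D k q X a c X-bound a-bound = ^-cancelʳ-≤ _ _ D (begin
  (d ^ (X * c)) ^ D   ≡⟨ ^-*-assoc d (X * c) D ⟩
  d ^ (X * c * D)     ≡⟨ cong (d ^_) (rearrange X c D) ⟩
  d ^ (D * c * X)     ≡⟨ ≡-sym (^-*-assoc d (D * c) X) ⟩
  (d ^ (D * c)) ^ X   ≤⟨ *-cancelʳ-≤ _ _ ((q ^ a) ^ X) {{m^n≢0 (q ^ a) X {{m^n≢0 q a}}}} core ⟩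
  (k ^ D) ^ a         ≡⟨ ^-swap k D a ⟩
  (k ^ a) ^ D         ∎)
  where
  open ≤-Reasoning
  rearrange : ∀ X c D → X * c * D ≡ D * c * X
  rearrange = solve-∀
  core : (d ^ (D * c)) ^ X * (q ^ a) ^ X ≤ (k ^ D) ^ a * (q ^ a) ^ X
  core = begin
    (d ^ (D * c)) ^ X * (q ^ a) ^ X   ≡⟨ ≡-sym (^-distribʳ-* (d ^ (D * c)) (q ^ a) X) ⟩
    (d ^ (D * c) * q ^ a) ^ X         ≤⟨ ^-monoˡ-≤ X (<⇒≤ a-bound) ⟩
    ((2 * d) ^ a) ^ X                 ≡⟨ ^-swap (2 * d) a X ⟩
    ((2 * d) ^ X) ^ a                 ≤⟨ ^-monoˡ-≤ a X-bound ⟩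
    (k ^ D * q ^ X) ^ a               ≡⟨ ^-distribʳ-* (k ^ D) (q ^ X) a ⟩
    (k ^ D) ^ a * (q ^ X) ^ a         ≡⟨ cong ((k ^ D) ^ a *_) (^-swap q X a) ⟩
    (k ^ D) ^ a * (q ^ a) ^ X         ∎

-- With b = 2d/(2d-1), the first inequality says X ≤ D log_b k. Hence d^X ≤ k^(D log_b d) = k^(pD),
-- and `N` stays below the real threshold.
¬Exceeds-intro : ∀ d D k X N .{{_ : NonZero D}} .{{_ : NonZero (2 * d ∸ 1)}} →
  (2 * d) ^ X ≤ k ^ D * (2 * d ∸ 1) ^ X →
  N ≤ 8 * d ^ (3 * D + 1) * k * d ^ X → ¬ Exceeds d D k N
¬Exceeds-intro d D k X N X-bound N≤ (a , c , _ , a-bound , exceeds) = <⇒≱ exceeds (begin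
  N ^ c                       ≤⟨ ^-monoˡ-≤ c N≤ ⟩
  (B * d ^ X) ^ c             ≡⟨ ^-distribʳ-* B (d ^ X) c ⟩
  B ^ c * (d ^ X) ^ c         ≡⟨ cong (B ^ c *_) (^-*-assoc d X c) ⟩
  B ^ c * d ^ (X * c)         ≤⟨ *-monoʳ-≤ (B ^ c) (d^X≤k^a d D k _ X a c X-bound a-bound) ⟩
  B ^ c * k ^ a               ≡⟨ *-comm (B ^ c) (k ^ a) ⟩
  k ^ a * B ^ c               ∎)
  where
  open ≤-Reasoning
  B = 8 * d ^ (3 * D + 1) * k

-- Sizes of balls in graphs of bounded degree.

geometric : ℕ → ℕ → ℕ
geometric d zero    = 1
geometric d (suc L) = geometric d L + d ^ suc L

geometric≤ : ∀ d L → 2 ≤ d → geometric d L ≤ 2 * d ^ L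
geometric≤ d zero    _   = s≤s z≤n
geometric≤ d (suc L) 2≤d = begin
  geometric d L + d ^ suc L   ≤⟨ +-monoˡ-≤ _ (geometric≤ d L 2≤d) ⟩
  2 * d ^ L + d ^ suc L       ≤⟨ +-monoˡ-≤ _ (*-monoˡ-≤ (d ^ L) 2≤d) ⟩
  d ^ suc L + d ^ suc L       ≡⟨ cong (d ^ suc L +_) (≡-sym (+-identityʳ _)) ⟩
  2 * d ^ suc L               ∎
  where open ≤-Reasoning

-- Each kept vertex comes with its own radius. The largest of these still satisfies the threshold
-- inequality and is an integer stand-in for D log_b k; `P 0` serves the empty family.
upper-bound : (P : ℕ → Set) → P 0 → (f : Fin n → ℕ) → (∀ i → P (f i)) →
  ∃[ X ] (P X × (∀ i → f i ≤ X))
upper-bound {zero}  P P0 f Pf = 0 , P0 , λ ()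
upper-bound {suc n} P P0 f Pf with upper-bound P P0 (f ∘ suc) (Pf ∘ suc)
... | X , PX , f≤X with ≤-total (f zero) X
...   | inj₁ f0≤X = X , PX , λ { zero → f0≤X ; (suc i) → f≤X i }
...   | inj₂ X≤f0 = f zero , Pf zero , λ { zero → ≤-refl ; (suc i) → ≤-trans (f≤X i) X≤f0 }

module Balls (B : Graph) (d : ℕ) (degree≤d : ∀ v → degree B v ≤ d) (T : Fin (size B) → Bool) where

  -- The number of walks of length `ℓ` from `v` into `T`. A vertex that reaches `T` has at least
  -- one, so counting walks bounds the number of such vertices from above.
  walks : ℕ → Fin (size B) → ℕ
  walks zero    v = ι (T v)
  walks (suc ℓ) v = ∑ λ u → ι (adj B v u) * walks ℓ u

  walks≤ : ℕ → Fin (size B) → ℕ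
  walks≤ zero    v = walks 0 v
  walks≤ (suc L) v = walks≤ L v + walks (suc L) v

  1≤walks : ∀ {v u ℓ} → Walk B v u ℓ → T u ≡ true → 1 ≤ walks ℓ v
  1≤walks here Tu = ≤-reflexive (cong ι (≡-sym Tu))
  1≤walks {v} (step {w = w} {m = ℓ} p walk) Tu = ≤-trans (1≤walks walk Tu)
    (≤-trans (≤-reflexive (trans (≡-sym (+-identityʳ _)) (cong (λ b → ι b * walks ℓ w) (≡-sym p))))
      (term≤∑ (λ u → ι (adj B v u) * walks ℓ u) w))

  walks≤walks≤ : ∀ {ℓ} L → ℓ ≤ L → ∀ v → walks ℓ v ≤ walks≤ L v
  walks≤walks≤ zero    z≤n v = ≤-refl
  walks≤walks≤ (suc L) ℓ≤  v with m≤n⇒m<n∨m≡n ℓ≤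
  ... | inj₁ (s≤s ℓ≤L) = ≤-trans (walks≤walks≤ L ℓ≤L v) (m≤m+n _ _)
  ... | inj₂ refl      = m≤n+m _ _

  -- After exchanging the sums, a walk that starts at `u` is prolonged backwards in `degree B u`
  -- ways.
  ∑-walks : ∀ ℓ → ∑ (walks ℓ) ≤ d ^ ℓ * ∑ (ι ∘ T)
  ∑-walks zero    = ≤-reflexive (≡-sym (+-identityʳ _))
  ∑-walks (suc ℓ) = begin
    ∑ (λ v → ∑ λ u → ι (adj B v u) * walks ℓ u)   ≡⟨ ∑-swap (λ v u → ι (adj B v u) * walks ℓ u) ⟩
    ∑ (λ u → ∑ λ v → ι (adj B v u) * walks ℓ u)   ≡⟨ ∑-cong (λ u → trans (∑-cong (λ v →
      trans (*-comm _ (walks ℓ u)) (cong (λ b → walks ℓ u * ι b) (Graph.sym B v u))))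
      (∑-* (walks ℓ u) (λ v → ι (adj B u v)))) ⟩
    ∑ (λ u → walks ℓ u * degree B u)              ≤⟨ ∑-mono (λ u → ≤-trans (*-monoʳ-≤ (walks ℓ u) (degree≤d u))
      (≤-reflexive (*-comm (walks ℓ u) d))) ⟩
    ∑ (λ u → d * walks ℓ u)                       ≡⟨ ∑-* d (walks ℓ) ⟩
    d * ∑ (walks ℓ)                               ≤⟨ *-monoʳ-≤ d (∑-walks ℓ) ⟩
    d * (d ^ ℓ * ∑ (ι ∘ T))                       ≡⟨ ≡-sym (*-assoc d _ _) ⟩
    d ^ suc ℓ * ∑ (ι ∘ T)                         ∎
    where open ≤-Reasoning

  ∑-walks≤ : ∀ L → ∑ (walks≤ L) ≤ geometric d L * ∑ (ι ∘ T)
  ∑-walks≤ zero    = ∑-walks 0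
  ∑-walks≤ (suc L) = begin
    ∑ (λ v → walks≤ L v + walks (suc L) v)                     ≡⟨ ∑-+ (walks≤ L) (walks (suc L)) ⟩
    ∑ (walks≤ L) + ∑ (walks (suc L))                           ≤⟨ +-mono-≤ (∑-walks≤ L) (∑-walks (suc L)) ⟩
    geometric d L * ∑ (ι ∘ T) + d ^ suc L * ∑ (ι ∘ T)          ≡⟨ ≡-sym (*-distribʳ-+ (∑ (ι ∘ T)) (geometric d L) _) ⟩
    geometric d (suc L) * ∑ (ι ∘ T)                            ∎
    where open ≤-Reasoning

  Reaches : ℕ → Fin (size B) → Set
  Reaches L v = ∃[ u ] ∃[ ℓ ] (Walk B v u ℓ × T u ≡ true × ℓ ≤ L)

  ball-size : ∀ L (e : Fin N → Fin (size B)) → Injective e → (∀ i → Reaches L (e i)) →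
    N ≤ geometric d L * ∑ (ι ∘ T)
  ball-size {N} L e e-inj reaches = begin
    N                            ≡⟨ ≡-sym (∑-1 N) ⟩
    ∑ {N} (λ _ → 1)              ≤⟨ ∑-mono (λ i → let u , ℓ , w , Tu , ℓ≤L = reaches i in
                                      ≤-trans (1≤walks w Tu) (walks≤walks≤ L ℓ≤L (e i))) ⟩
    ∑ (walks≤ L ∘ e)             ≤⟨ ∑-injective e e-inj (walks≤ L) ⟩
    ∑ (walks≤ L)                 ≤⟨ ∑-walks≤ L ⟩
    geometric d L * ∑ (ι ∘ T)    ∎
    where open ≤-Reasoning

  -- In a matching every walk backtracks, so radius 1 suffices; the geometric sum is only
  -- comparable to its last term for 2 ≤ d.
  shorten : d ≡ 1 → ∀ {v u ℓ} → Walk B v u ℓ → ∃[ ℓ′ ] (ℓ′ ≤ 1 × Walk B v u ℓ′)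
  shorten d≡1 here       = 0 , z≤n , here
  shorten d≡1 {v} (step {w = w} p walk) with shorten d≡1 walk
  ... | _ , _ , here = 1 , ≤-refl , step p here
  ... | _ , _ , step {w = u} p′ here with u ≟ v
  ...   | yes refl = 0 , z≤n , here
  ...   | no u≢v   = ⊥-elim (<⇒≱ (two≤∑ (adj B w) u≢v p′ (trans (Graph.sym B w v) p))
    (≤-trans (degree≤d w) (≤-reflexive d≡1)))
  shorten d≡1 {v} (step {w = w} p walk) | _ , s≤s () , step _ (step _ _)

  ball-size-exp : ∀ L (e : Fin N → Fin (size B)) → Injective e → 1 ≤ d → (∀ i → Reaches L (e i)) →
    N ≤ 2 * d ^ L * ∑ (ι ∘ T)
  ball-size-exp L e e-inj 1≤d reaches with m≤n⇒m<n∨m≡n 1≤d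
  ... | inj₁ 2≤d  = ≤-trans (ball-size L e e-inj reaches) (*-monoˡ-≤ _ (geometric≤ d L 2≤d))
  ... | inj₂ refl = ≤-trans
    (ball-size 1 e e-inj λ i →
      let u , _ , w , Tu , _ = reaches i
          ℓ , ℓ≤1 , w′       = shorten refl w
      in u , ℓ , w′ , Tu , ℓ≤1)
    -- For `d` = 1 the geometric sum of radius 1 is 2, which is also 2 times 1^L.
    (≤-reflexive (cong (λ x → 2 * x * ∑ (ι ∘ T)) (≡-sym (^-zeroˡ L))))

-- The walk is cut at its first vertex incident with a deleted edge. All earlier edges survive, so
-- the walk runs in the solved graph, where degrees are bounded.
first-missing : ∀ G S {v u ℓ} → Walk G v u ℓ → touched (missing G S) u ≡ true →
  ∃[ u′ ] ∃[ ℓ′ ] (Walk (subGraph G S) v u′ ℓ′ × touched (missing G S) u′ ≡ true × ℓ′ ≤ ℓ)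
first-missing G S here Tu = _ , 0 , here , Tu , z≤n
first-missing G S {v} (step {w = w} p walk) Tu with touched (missing G S) v in Tv
... | true  = v , 0 , here , Tv , z≤n
... | false with u′ , ℓ′ , walk′ , Tu′ , ℓ′≤ ← first-missing G S walk Tu =
  u′ , suc ℓ′ , step (trans (sadj≡adj G S λ m → true≢false (touched-intro (missing G S) m) Tv) p) walk′ , Tu′ , s≤s ℓ′≤

-- Restricting and extending solutions along an induced embedding.

deleted-restrict : ∀ (e : InducedEmb H G) S S′ →
  (∀ i j → missing H S′ i j ≡ true → missing G S (emb e i) (emb e j) ≡ true) →
  deleted H S′ ≤ deleted G S
deleted-restrict {H} {G} e S S′ h = *-cancelˡ-≤ 2 (begin
  2 * deleted H S′           ≡⟨ ≡-sym (ordered≡2*edges (missing H S′) (missing-sym H S′) (missing-irrefl H S′)) ⟩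
  ordered (missing H S′)     ≤⟨ ∑-mono (λ i → ≤-trans (∑-mono (λ j → ι-mono _ _ (h i j)))
                                  (∑-injective (emb e) (emb-inj e) (λ y → ι (missing G S (emb e i) y)))) ⟩
  ∑ (λ i → ∑ λ y → ι (missing G S (emb e i) y))
                             ≤⟨ ∑-injective (emb e) (emb-inj e) (λ x → ∑ λ y → ι (missing G S x y)) ⟩
  ordered (missing G S)      ≡⟨ ordered≡2*edges (missing G S) (missing-sym G S) (missing-irrefl G S) ⟩
  2 * deleted G S            ∎)
  where open ≤-Reasoning

YesInstance-restrict : ∀ {ℋ k} → InducedEmb H G → YesInstance ℋ G k → YesInstance ℋ H k
YesInstance-restrict {H} {G} e (S , S≤k , free) = S′ ,
  ≤-trans (deleted-restrict e S S′ λ i j p → trans (cong (_∧ not (sadj S′ i j)) (emb-adj e i j)) p) S≤k ,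
  λ F F∈ℋ c → free F F∈ℋ (record { emb = emb e ; emb-inj = emb-inj e ; emb-adj = λ _ _ → refl } ∘ᵉ c)
  where
  S′ : SpanningSub H
  S′ = record
    { sadj    = λ i j → sadj S (emb e i) (emb e j)
    ; ssym    = λ i j → ssym S _ _
    ; sirrefl = λ i → sirrefl S _
    ; ssub    = λ i j p → trans (≡-sym (emb-adj e i j)) (ssub S _ _ p)
    }

module Extend {H G : Graph} (e : InducedEmb H G) (S : SpanningSub H) where

  Image : BRel (size G)
  Image x y = does (any? λ i → any? λ j → emb e i ≟ x ×-dec emb e j ≟ y ×-dec missing H S i j ≟ᵇ true)

  Image-intro : ∀ {i j} → missing H S i j ≡ true → Image (emb e i) (emb e j) ≡ true
  Image-intro {i} {j} p = dec-true (any? _) (i , j , refl , refl , p)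

  Image-elim : ∀ {x y} → Image x y ≡ true → ∃[ i ] ∃[ j ] (emb e i ≡ x × emb e j ≡ y × missing H S i j ≡ true)
  Image-elim p = does⇒ (any? _) p

  Image-sym : Symmetric Image
  Image-sym x y = ≡-ext (flip x y) (flip y x)
    where
    flip : ∀ x y → Image x y ≡ true → Image y x ≡ true
    flip x y p with i , j , refl , refl , m ← Image-elim p = Image-intro (trans (missing-sym H S j i) m)

  Image-reflect : ∀ {i j} → Image (emb e i) (emb e j) ≡ true → missing H S i j ≡ true
  Image-reflect p with i , j , pi , pj , m ← Image-elim p with emb-inj e _ _ pi | emb-inj e _ _ pj
  ... | refl | refl = m

  S⁺ : SpanningSub G
  S⁺ = remove G Image Image-sym

  missing⁺⇒ : ∀ {x y} → missing G S⁺ x y ≡ true → Image x y ≡ true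
  missing⁺⇒ = missing-remove G Image Image-sym

  -- Both ends of every edge deleted in `G` lie in the image of `e`, so both sums can be pulled back
  -- along `e`.
  deleted-S⁺ : deleted G S⁺ ≤ deleted H S
  deleted-S⁺ = *-cancelˡ-≤ 2 (begin
    2 * deleted G S⁺         ≡⟨ ≡-sym (ordered≡2*edges M (missing-sym G S⁺) (missing-irrefl G S⁺)) ⟩
    ordered M                ≤⟨ ∑-image (emb e) (λ x → ∑ λ y → ι (M x y)) left ⟩
    ∑ (λ i → ∑ λ y → ι (M (emb e i) y))
                             ≤⟨ ∑-mono (λ i → ∑-image (emb e) (λ y → ι (M (emb e i) y)) (right i)) ⟩
    ∑ (λ i → ∑ λ j → ι (M (emb e i) (emb e j)))
                             ≤⟨ ∑-mono (λ i → ∑-mono (inner i)) ⟩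
    ordered (missing H S)    ≡⟨ ordered≡2*edges (missing H S) (missing-sym H S) (missing-irrefl H S) ⟩
    2 * deleted H S          ∎)
    where
    open ≤-Reasoning
    M : BRel (size G)
    M = missing G S⁺
    inner : ∀ i j → ι (M (emb e i) (emb e j)) ≤ ι (missing H S i j)
    inner i j = ι-mono (M (emb e i) (emb e j)) _ λ p → Image-reflect (missing⁺⇒ p)
    1≤ι : ∀ b → 1 ≤ ι b → b ≡ true
    1≤ι true _ = refl
    right : ∀ i y → 1 ≤ ι (M (emb e i) y) → ∃[ j ] emb e j ≡ y
    right i y h with _ , j , _ , pj , _ ← Image-elim (missing⁺⇒ (1≤ι (M (emb e i) y) h)) = j , pj
    left : ∀ x → 1 ≤ ∑ (λ y → ι (M x y)) → ∃[ i ] emb e i ≡ x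
    left x h with _ , _ , hit ← pick (M x) 1 h with i , _ , pi , _ ← Image-elim (missing⁺⇒ (hit zero)) = i , pi

  pull-back : (c : InducedEmb F (subGraph G S⁺)) → (∀ a → ∃[ i ] emb e i ≡ emb c a) →
    InducedEmb F (subGraph H S)
  pull-back {F} c inside = record
    { emb     = λ a → proj₁ (inside a)
    ; emb-inj = λ a b p → emb-inj c a b
        (trans (≡-sym (proj₂ (inside a))) (trans (cong (emb e) p) (proj₂ (inside b))))
    ; emb-adj = λ a b → trans (≡-sym (restricts _ _))
        (trans (cong₂ (sadj S⁺) (proj₂ (inside a)) (proj₂ (inside b))) (emb-adj c a b))
    }
    where
    restricts : ∀ i j → sadj S⁺ (emb e i) (emb e j) ≡ sadj S i j
    restricts i j = ≡-ext
      (λ p → trans (sadj≡adj H S λ m → true≢false (Image-intro m)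
                (not-true (∧-conicalʳ (adj G (emb e i) (emb e j)) _ p)))
              (trans (≡-sym (emb-adj e i j)) (∧-conicalˡ _ _ p)))
      (λ p → cong₂ (λ a b → a ∧ not b) (trans (emb-adj e i j) (ssub S i j p))
        (≢true λ m → true≢false p (missing-elim H S (Image-reflect m))))

-- The kernel: equivalence and size.

module Kernel
  (ℋ : List Graph) (s : ℕ) (1<s : 1 < s) 
  (K : Graph) (K∈ℋ : K ∈ ℋ) (κ : InducedEmb K (star s)) (κ-onto : ∀ v → ∃[ i ] emb κ i ≡ v)
  (D : ℕ) (diam : ∀ F → F ∈ ℋ → ∀ u v → ∃[ ℓ ] (ℓ ≤ D × Walk F u v ℓ))
  (t : ℕ) (2≤t : 2 ≤ t) (d : ℕ) (ramsey : RamseyProp s t (suc d))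
  (k : ℕ) (1≤k : 1 ≤ k)
  where

  private
    q = 2 * d ∸ 1

  1≤d : 1 ≤ d
  1≤d = s≤s⁻¹ (≤-trans 1<s (RamseyProp⇒s≤R 2≤t ramsey))

  1≤q : 1 ≤ q
  1≤q = ∸-monoˡ-≤ 1 (*-monoʳ-≤ 2 1≤d)

  instance
    d-nonZero : NonZero d
    d-nonZero = >-nonZero 1≤d

    q-nonZero : NonZero q
    q-nonZero = >-nonZero 1≤q

    k-nonZero : NonZero k
    k-nonZero = >-nonZero 1≤k

  -- The centre and a leaf of the star are distinct, so the walk between their preimages has a step.
  -- `go` generalises `s` so that matching on `1 < s` exposes a leaf.
  1≤D : 1 ≤ D
  1≤D = go 1<s κ κ-onto
    where
    go : ∀ {s} → 1 < s → (c : InducedEmb K (star s)) → (∀ v → ∃[ i ] emb c i ≡ v) → 1 ≤ D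
    go (s≤s _) c onto with onto zero | onto (suc zero)
    ... | a , pa | b , pb with diam K K∈ℋ a b
    ...   | _ , ℓ≤D , step _ _ = ≤-trans (s≤s z≤n) ℓ≤D
    ...   | _ , _ , here with () ← trans (≡-sym pa) pb

  instance
    D-nonZero : NonZero D
    D-nonZero = >-nonZero 1≤D

  -- The vertex is the centre of an induced `star s`; hence V_R is contained in V_H.
  high-degree⇒InVH : ∀ G → ¬ HasClique G (suc t) → ∀ v → suc d ≤ degree G v → InVH ℋ G v
  high-degree⇒InVH G no-clique v big
    with e , refl ← big-degree-star ramsey G no-clique v big | i , κi≡0 ← κ-onto zero =
    K , K∈ℋ , e ∘ᵉ κ , i , cong (emb e) κi≡0

  ¬YesInstance-star : ¬ YesInstance ℋ (star s) 0
  ¬YesInstance-star (S , S≤0 , free) = free K K∈ℋ (copy-in-sub S κ λ (a , b , m) → <⇒≱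
    (1≤edges (missing (star s) S) (missing-sym (star s) S) (missing-irrefl (star s) S) m) S≤0)

  -- The radius 0 suffices, since s + 1 ≤ R + 1 = d + 2 ≤ 8d.
  ¬Exceeds-star : ¬ Exceeds d D k (suc s)
  ¬Exceeds-star = ¬Exceeds-intro d D k 0 (suc s) (≤-trans (m^n>0 k D) (≤-reflexive (≡-sym (*-identityʳ _)))) (begin
    suc s                             ≤⟨ s≤s (RamseyProp⇒s≤R 2≤t ramsey) ⟩
    2 + d                             ≤⟨ +-mono-≤ (*-monoʳ-≤ 2 1≤d) (m≤m+n d (5 * d)) ⟩
    2 * d + 6 * d                     ≡⟨ ≡-sym (*-distribʳ-+ d 2 6) ⟩
    8 * d                             ≡⟨ cong (8 *_) (≡-sym (^-identityʳ d)) ⟩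
    8 * d ^ 1                         ≤⟨ *-monoʳ-≤ 8 (^-monoʳ-≤ d (m≤n+m 1 (3 * D))) ⟩
    8 * d ^ (3 * D + 1)               ≤⟨ m≤m*n _ k ⟩
    8 * d ^ (3 * D + 1) * k           ≡⟨ ≡-sym (*-identityʳ _) ⟩
    8 * d ^ (3 * D + 1) * k * d ^ 0   ∎)
    where open ≤-Reasoning

  -- With b = 2d/(2d-1): b^i ≤ k and x ≤ iD give b^x ≤ k^D.
  within-radius : ∀ i x → (2 * d) ^ i ≤ k * q ^ i → x ≤ i * D → (2 * d) ^ x ≤ k ^ D * q ^ x
  within-radius i x i-bound x≤iD = *-cancelʳ-≤ _ _ (q ^ y) {{m^n≢0 q y}} (begin
    (2 * d) ^ x * q ^ y          ≤⟨ *-monoʳ-≤ ((2 * d) ^ x) (^-monoˡ-≤ y (m∸n≤m (2 * d) 1)) ⟩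
    (2 * d) ^ x * (2 * d) ^ y    ≡⟨ ≡-sym (^-distribˡ-+-* (2 * d) x y) ⟩
    (2 * d) ^ (x + y)            ≡⟨ cong ((2 * d) ^_) (m+[n∸m]≡n x≤iD) ⟩
    (2 * d) ^ (i * D)            ≡⟨ ≡-sym (^-*-assoc (2 * d) i D) ⟩
    ((2 * d) ^ i) ^ D            ≤⟨ ^-monoˡ-≤ D i-bound ⟩
    (k * q ^ i) ^ D              ≡⟨ ^-distribʳ-* k (q ^ i) D ⟩
    k ^ D * (q ^ i) ^ D          ≡⟨ cong (k ^ D *_) (^-*-assoc q i D) ⟩
    k ^ D * q ^ (i * D)          ≡⟨ cong (λ z → k ^ D * q ^ z) (≡-sym (m+[n∸m]≡n x≤iD)) ⟩
    k ^ D * q ^ (x + y)          ≡⟨ cong (k ^ D *_) (^-distribˡ-+-* q x y) ⟩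
    k ^ D * (q ^ x * q ^ y)      ≡⟨ ≡-sym (*-assoc (k ^ D) _ _) ⟩
    k ^ D * q ^ x * q ^ y        ∎)
    where
    open ≤-Reasoning
    y = i * D ∸ x

  module _ (G : Graph) (no-clique : ¬ HasClique G (suc t))
    (G′ : Graph) (e : InducedEmb G′ G)
    (kept : ∀ v → Kept ℋ d D k G v ⇔ (∃[ i ] emb e i ≡ v))
    where

    InVH⇒kept : ∀ v → InVH ℋ G v → ∃[ i ] emb e i ≡ v
    InVH⇒kept v v∈VH = Equivalence.to (kept v)
      (v , inj₁ v∈VH , 0 , here , subst (λ x → (2 * d) ^ x ≤ k ^ D * q ^ x) (≡-sym (0∸n≡0 (2 * D)))
        (≤-trans (m^n>0 k D) (≤-reflexive (≡-sym (*-identityʳ _)))))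

    small-degree : ∀ v → ¬ InVH ℋ G′ v → degree G′ v ≤ d
    small-degree v v∉VH = ≮⇒≥ λ big →
      v∉VH (high-degree⇒InVH G′ (no-clique ∘ HasClique-emb e) v big)

    open Layers ℋ D diam k d 1≤d G′ small-degree

    -- The copy accounts for one `D` and the layers for `j * D`. As only b^(j ∸ 1) ≤ k is known, one
    -- layer is split off; with the copy it makes up the 2D in the radius.
    near⇒kept : ∀ {z v ℓ} → Near z → Walk G v (emb e z) ℓ → ℓ ≤ D → ∃[ i ] emb e i ≡ v
    near⇒kept {v = v} {ℓ} (j , (u , u∈VH , ℓ′ , w , ℓ′≤) , j-bound) walk ℓ≤D = Equivalence.to (kept v)
      (emb e u , inj₁ (InVH-emb e u∈VH) , ℓ + ℓ′ , walk ++ʷ walk-emb e w ,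
       within-radius (j ∸ 1) _ j-bound (m≤n+o⇒m∸n≤o (ℓ + ℓ′) (2 * D) (begin
         ℓ + ℓ′                    ≤⟨ +-mono-≤ ℓ≤D ℓ′≤ ⟩
         D + j * D                 ≤⟨ +-monoʳ-≤ D (*-monoˡ-≤ D (m≤n+m∸n j 1)) ⟩
         D + (D + (j ∸ 1) * D)     ≡⟨ rearrange D ((j ∸ 1) * D) ⟩
         2 * D + (j ∸ 1) * D       ∎)))
      where
      open ≤-Reasoning
      rearrange : ∀ D x → D + (D + x) ≡ 2 * D + x
      rearrange = solve-∀

    -- The given solution is first replaced by one whose deleted edges are all near V_H. A copy left
    -- in `G` by its extension then lies inside `G′`, where `free` excludes it.
    YesInstance-extend : YesInstance ℋ G′ k → YesInstance ℋ G k
    YesInstance-extend (S₀ , S₀≤k , S₀-free)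
      with S , S≤k , free , near ← nearSolution 1≤k (suc (deleted G′ S₀)) S₀ ≤-refl S₀≤k S₀-free =
      S⁺ , ≤-trans deleted-S⁺ S≤k , λ F F∈ℋ c → free F F∈ℋ (pull-back c (inside F∈ℋ c))
      where
      open Extend e S
      inside : ∀ {F} → F ∈ ℋ → (c : InducedEmb F (subGraph G S⁺)) → ∀ a → ∃[ i ] emb e i ≡ emb c a
      inside {F} F∈ℋ c a with meetsMissing? G S⁺ (emb c)
      -- Without a deleted pair it is a copy in `G`, so its vertices are in V_H.
      ... | no none with c′ , same ← copy-of-sub {G = G} S⁺ c none =
        InVH⇒kept (emb c a) (F , F∈ℋ , c′ , a , same a)
      ... | yes (x , y , m) with i , j , ci , cj , m′ ← Image-elim (missing⁺⇒ m) with near i j m′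
      ...   | inj₁ near-i with ℓ , ℓ≤D , w ← diam F F∈ℋ a x =
        near⇒kept near-i (subst (λ z → Walk G (emb c a) z ℓ) (≡-sym ci) (walk-sub S⁺ c w)) ℓ≤D
      ...   | inj₂ near-j with ℓ , ℓ≤D , w ← diam F F∈ℋ a y =
        near⇒kept near-j (subst (λ z → Walk G (emb c a) z ℓ) (≡-sym cj) (walk-sub S⁺ c w)) ℓ≤D

    module _ (S : SpanningSub G) (S≤k : deleted G S ≤ k) (free : Free ℋ (subGraph G S)) where

      private
        T : Fin (size G) → Bool
        T = touched (missing G S)

      -- Deleting edges creates no clique, so a vertex of degree above `d` would lie in a copy,
      -- against `free`.
      sub-degree : ∀ v → degree (subGraph G S) v ≤ d
      sub-degree v = ≮⇒≥ λ big →
        let F , F∈ℋ , c , _ = high-degree⇒InVH (subGraph G S)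
              (λ (f , f-inj , full) → no-clique (f , f-inj , λ i j i≢j → ssub S _ _ (full i j i≢j))) v big
        in free F F∈ℋ c

      open Balls (subGraph G S) d sub-degree T

      InVH⇒walk : ∀ u → InVH ℋ G u → ∃[ x ] ∃[ ℓ ] (Walk G u x ℓ × T x ≡ true × ℓ ≤ D)
      InVH⇒walk u (F , F∈ℋ , c , i , refl) with meetsMissing? G S (emb c)
      ... | no none = ⊥-elim (free F F∈ℋ (copy-in-sub S c none))
      ... | yes (a , b , m) with ℓ , ℓ≤D , w ← diam F F∈ℋ i a =
        emb c a , ℓ , walk-emb c w , touched-intro (missing G S) m , ℓ≤D

      ∑T≤2k : ∑ (ι ∘ T) ≤ 2 * k
      ∑T≤2k = ≤-trans (∑-touched (missing G S)) (≤-trans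
        (≤-reflexive (ordered≡2*edges (missing G S) (missing-sym G S) (missing-irrefl G S))) (*-monoʳ-≤ 2 S≤k))

      -- Beyond `X`, the kept radius contributes 2D, and the copy through a vertex of V_H
      -- contributes D more on the way to a deleted edge.
      kept-reaches : ∀ {X v} ((_ , _ , ℓ , _) : Kept ℋ d D k G v) → ℓ ∸ 2 * D ≤ X → Reaches (3 * D + X) v
      kept-reaches {X} {v} (u , u∈ , ℓ , w , _) ℓ≤
        with x , ℓ′ , w′ , Tx , ℓ′≤D ← InVH⇒walk u ([ id , high-degree⇒InVH G no-clique u ]′ u∈)
        with y , ℓ″ , w″ , Ty , ℓ″≤ ← first-missing G S (w ++ʷ w′) Tx =
        y , ℓ″ , w″ , Ty , (begin
          ℓ″                              ≤⟨ ℓ″≤ ⟩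
          ℓ + ℓ′                          ≤⟨ +-mono-≤ (m≤n+m∸n ℓ (2 * D)) ℓ′≤D ⟩
          2 * D + (ℓ ∸ 2 * D) + D         ≤⟨ +-monoˡ-≤ D (+-monoʳ-≤ (2 * D) ℓ≤) ⟩
          2 * D + X + D                   ≡⟨ rearrange D X ⟩
          3 * D + X                       ∎)
        where
        open ≤-Reasoning
        rearrange : ∀ D X → 2 * D + X + D ≡ 3 * D + X
        rearrange = solve-∀

      radius : ∀ {v} → Kept ℋ d D k G v → ℕ
      radius (_ , _ , ℓ , _) = ℓ ∸ 2 * D
      radius-bound : ∀ {v} (κ : Kept ℋ d D k G v) → (2 * d) ^ radius κ ≤ k ^ D * q ^ radius κ
      radius-bound (_ , _ , _ , _ , within) = within

      ¬Exceeds-kernel : ¬ Exceeds d D k (size G′)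
      ¬Exceeds-kernel with X , X-bound , X-max ← upper-bound (λ x → (2 * d) ^ x ≤ k ^ D * q ^ x)
        (≤-trans (m^n>0 k D) (≤-reflexive (≡-sym (*-identityʳ _))))
        (λ i → radius (Equivalence.from (kept (emb e i)) (i , refl)))
        (λ i → radius-bound (Equivalence.from (kept (emb e i)) (i , refl))) =
        ¬Exceeds-intro d D k X (size G′) X-bound (begin
          size G′                                ≤⟨ ball-size-exp (3 * D + X) (emb e) (emb-inj e) 1≤d
                                                      (λ i → kept-reaches (Equivalence.from (kept (emb e i)) (i , refl)) (X-max i)) ⟩
          2 * d ^ (3 * D + X) * ∑ (ι ∘ T)        ≤⟨ *-monoʳ-≤ (2 * d ^ (3 * D + X)) ∑T≤2k ⟩
          2 * d ^ (3 * D + X) * (2 * k)          ≡⟨ cong (λ z → 2 * z * (2 * k)) (^-distribˡ-+-* d (3 * D) X) ⟩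
          2 * (d ^ (3 * D) * d ^ X) * (2 * k)    ≡⟨ rearrange (d ^ (3 * D)) (d ^ X) k ⟩
          -- The factor 4 comes from the geometric sum and from the two ends of each deleted edge;
          -- the threshold leaves slack up to 8d.
          4 * d ^ (3 * D) * k * d ^ X            ≤⟨ *-monoˡ-≤ (d ^ X) (*-monoˡ-≤ k (*-mono-≤ (m≤n+m 4 4)
                                                      (^-monoʳ-≤ d (m≤m+n (3 * D) 1)))) ⟩
          8 * d ^ (3 * D + 1) * k * d ^ X        ∎)
        where
        open ≤-Reasoning
        rearrange : ∀ a x k → 2 * (a * x) * (2 * k) ≡ 4 * a * k * x
        rearrange = solve-∀

    kernelization : (Exceeds d D k (size G′) →
        ¬ Exceeds d D k (size (star s)) × (YesInstance ℋ (star s) 0 ⇔ YesInstance ℋ G k)) ×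
      (¬ Exceeds d D k (size G′) →
        ¬ Exceeds d D k (size G′) × (YesInstance ℋ G′ k ⇔ YesInstance ℋ G k))
    kernelization =
      -- An oversized `G′` refutes every solution of `G`, so both sides of the equivalence are
      -- false.
      (λ exceeds → ¬Exceeds-star , mk⇔ (⊥-elim ∘ ¬YesInstance-star)
        λ (S , S≤k , free) → ⊥-elim (¬Exceeds-kernel S S≤k free exceeds)) ,
      (λ ¬exceeds → ¬exceeds , mk⇔ YesInstance-extend (YesInstance-restrict e))

theorem2 : (ℋ : List Graph) → All Connected ℋ →
    (s : ℕ) → 1 < s → ContainsStar ℋ s →
    (∀ s′ → 1 < s′ → s′ < s → ¬ ContainsStar ℋ s′) →
    (D : ℕ) → IsMaxDiameter ℋ D →
    (t : ℕ) → 2 < t → (R : ℕ) → IsRamsey s (t ∸ 1) R →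
    (G : Graph) → ¬ HasClique G t → (k : ℕ) → 1 ≤ k →
    (G′ : Graph) → (e : InducedEmb G′ G) →
    (∀ v → Kept ℋ (R ∸ 1) D k G v ⇔ (∃[ i ] emb e i ≡ v)) →
    (Exceeds (R ∸ 1) D k (size G′) →
    ¬ Exceeds (R ∸ 1) D k (size (star s)) ×
    (YesInstance ℋ (star s) 0 ⇔ YesInstance ℋ G k)) ×
    (¬ Exceeds (R ∸ 1) D k (size G′) →
    ¬ Exceeds (R ∸ 1) D k (size G′) ×
    (YesInstance ℋ G′ k ⇔ YesInstance ℋ G k))
-- The `t` of `Kernel` is one less than that of the statement, and `R` is `suc d`.
theorem2 ℋ _ s 1<s (K , K∈ℋ , κ , κ-onto) _ D (diam , _) (suc t) 2<t (suc d) (ramsey , _) G no-clique k 1≤k G′ e kept =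
  Kernel.kernelization ℋ s 1<s K K∈ℋ κ κ-onto D diam t (s≤s⁻¹ 2<t) d ramsey k 1≤k G no-clique G′ e kept
-- `R` = 0 is impossible because 1 ≤ s ≤ R.
theorem2 _ _ _ 1<s _ _ _ _ (suc _) 2<t zero (ramsey , _)
  with () ← ≤-trans (<⇒≤ 1<s) (RamseyProp⇒s≤R (s≤s⁻¹ 2<t) ramsey)
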